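{- For every $n\in\mathbb{N}$ and every real $\alpha>\frac{\log 2}{\log(1+\sqrt{2})}$ (which is approximately $0.7865$), there exist $k\ge n$ and a subdivision $G$ of the $k$-ladder such that $|\Lambda(G)|\le k^{\alpha}$.
   Context: The $k$-ladder is the Cartesian product of $K_2$ and a path on $k$ vertices. A subdivision of a graph $H$ is a graph obtained from $H$ by replacing each edge by a path of length at least $1$ with the same ends, these paths being internally disjoint from each other and from $V(H)$. The cycle spectrum of a graph $G$ is $\Lambda(G)=\{\ell\in\mathbb{N}\mid G\text{ contains a cycle of length }\ell\}$. -}

module Defs where

open import Algebra.Definitions.RawSemiring using () renaming (_^_ to power)
open import Data.Fin.Base using (Fin; toℕ)
open import Data.Integer.Base as ℤ using (ℤ; +_; 0ℤ)
open import Data.List.Base using (List; _∷_; _∷ʳ_; _++_; length; reverse)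
open import Data.List.Membership.Propositional using (_∈_)
open import Data.List.Relation.Unary.Linked using (Linked)
open import Data.List.Relation.Unary.Unique.Propositional using (Unique)
open import Data.Nat.Base as ℕ using (ℕ; zero; suc; _!)
import Data.Nat.Properties as ℕ
open import Data.Product.Base using (Σ-syntax; ∃; ∃-syntax; _×_; _,_)
open import Data.Rational.Base as ℚ using (ℚ; 0ℚ; 1ℚ; ↥_; ↧ₙ_)
open import Data.Sum.Base using (_⊎_; inj₁; inj₂)
open import Function.Base using (_∘_)
open import Function.Bundles using (_⇔_)
open import Level using (0ℓ)
open import Relation.Binary.Core using (Rel)
open import Relation.Binary.Definitions using (Symmetric; Irreflexive)
open import Relation.Binary.PropositionalEquality using (_≡_; _≢_; refl; sym)
open import Relation.Nullary.Negation using (¬_)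
open import Relation.Unary using (Pred)

-- A number x is given by the rationals below it and the rationals above it.
-- The operations act on the cuts alone; the Dedekind axioms are bundled in ℝ.
record Cut : Set₁ where
  field
    Below : Pred ℚ 0ℓ
    Above : Pred ℚ 0ℓ

open Cut public

record IsDedekind (x : Cut) : Set where
  field
    below-inhabited : ∃[ q ] Below x q
    above-inhabited : ∃[ q ] Above x q
    below-rounded   : ∀ q → Below x q ⇔ (∃[ r ] q ℚ.< r × Below x r)
    above-rounded   : ∀ q → Above x q ⇔ (∃[ r ] r ℚ.< q × Above x r)
    disjoint        : ∀ q → ¬ (Below x q × Above x q)
    located         : ∀ q r → q ℚ.< r → Below x q ⊎ Above x r

record ℝ : Set₁ where
  field
    cut        : Cut
    isDedekind : IsDedekind cut

open ℝ public

infix 4 _<_ _≤_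

_<_ : Cut → Cut → Set
x < y = ∃[ q ] Above x q × Below y q

_≤_ : Cut → Cut → Set
x ≤ y = ∀ q → Below x q → Below y q

fromℚ : ℚ → Cut
fromℚ p = record { Below = λ q → q ℚ.< p ; Above = λ q → p ℚ.< q }

fromℕ : ℕ → Cut
fromℕ n = fromℚ (+ n ℚ./ 1)

infixl 6 _+_
infixl 7 _÷_
infixr 8 _^_ _^ℚ_ _^ℕ_

_+_ : Cut → Cut → Cut
x + y = record
  { Below = λ q → ∃[ r ] ∃[ s ] Below x r × Below y s × q ≡ r ℚ.+ s
  ; Above = λ q → ∃[ r ] ∃[ s ] Above x r × Above y s × q ≡ r ℚ.+ s
  }

-- Only meaningful for x > 0 and y > 0.
_÷_ : Cut → Cut → Cut
x ÷ y = record
  { Below = λ q → ∃[ r ] ∃[ s ] Below x r × Above y s × q ℚ.* s ℚ.< r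
  ; Above = λ q → ∃[ r ] ∃[ s ] Above x r × Below y s × 0ℚ ℚ.< s × r ℚ.< q ℚ.* s
  }

-- Only meaningful for x ≥ 0.
√_ : Cut → Cut
√ x = record
  { Below = λ q → q ℚ.< 0ℚ ⊎ Below x (q ℚ.* q)
  ; Above = λ q → 0ℚ ℚ.< q × Above x (q ℚ.* q)
  }

_^ℕ_ : ℚ → ℕ → ℚ
_^ℕ_ = power ℚ.+-*-rawSemiring

_⁺ _⁻ : ℤ → ℕ
i ⁺ = ℤ.∣ i ℤ.⊔ 0ℤ ∣
i ⁻ = (ℤ.- i) ⁺

-- Rational power of x > 0.  If w = (m - n) / d with m, n the positive and
-- negative parts of the numerator, then for q > 0 the inequality q < x ^ w
-- means q ^ d * x ^ n < x ^ m, and this is witnessed by rationals s and t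
-- with 0 < s < x < t.  Likewise for x ^ w < q.
_^ℚ_ : Cut → ℚ → Cut
x ^ℚ w = record
  { Below = λ q → q ℚ.≤ 0ℚ ⊎
      (∃[ s ] ∃[ t ] Below x s × 0ℚ ℚ.< s × Above x t ×
        (q ^ℕ ↧ₙ w) ℚ.* (t ^ℕ (↥ w) ⁻) ℚ.< s ^ℕ (↥ w) ⁺)
  ; Above = λ q → 0ℚ ℚ.< q ×
      (∃[ s ] ∃[ t ] Below x s × 0ℚ ℚ.< s × Above x t ×
        t ^ℕ (↥ w) ⁺ ℚ.< (q ^ℕ ↧ₙ w) ℚ.* (s ^ℕ (↥ w) ⁻))
  }

-- Real power of x ≥ 1: the supremum of x ^ w over rational w < y, which is
-- also the infimum over rational w > y.
_^_ : Cut → Cut → Cut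
x ^ y = record
  { Below = λ q → ∃[ w ] Below y w × Below (x ^ℚ w) q
  ; Above = λ q → ∃[ w ] Above y w × Above (x ^ℚ w) q
  }

expSum : ℕ → ℚ
expSum zero    = 1ℚ
expSum (suc n) = expSum n ℚ.+ (+ 1 ℚ./ (suc n !)) {{ (suc n) ℕ.!≢0 }}

-- The supremum of the partial sums of ∑ 1 / n!.
e : Cut
e = record
  { Below = λ q → ∃[ n ] q ℚ.< expSum n
  ; Above = λ q → ∃[ r ] r ℚ.< q × (∀ n → expSum n ℚ.≤ r)
  }

-- Natural logarithm of x > 0: w < log x means e ^ w < x.
log : Cut → Cut
log x = record
  { Below = λ w → e ^ℚ w < x
  ; Above = λ w → x < e ^ℚ w
  }

record Graph : Set₁ where
  infix 4 _~_
  field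
    Vertex : Set
    _~_    : Rel Vertex 0ℓ
    ~-sym  : Symmetric _~_
    ~-irr  : Irreflexive _≡_ _~_

open Graph using (Vertex)

K : ℕ → Graph
K n = record
  { Vertex = Fin n
  ; _~_    = _≢_
  ; ~-sym  = λ i≢j → i≢j ∘ sym
  ; ~-irr  = λ i≡j i≢j → i≢j i≡j
  }

P : ℕ → Graph
P k = record
  { Vertex = Fin k
  ; _~_    = λ i j → suc (toℕ i) ≡ toℕ j ⊎ suc (toℕ j) ≡ toℕ i
  ; ~-sym  = λ { (inj₁ p) → inj₂ p ; (inj₂ p) → inj₁ p }
  ; ~-irr  = λ { refl (inj₁ p) → ℕ.1+n≢n p ; refl (inj₂ p) → ℕ.1+n≢n p }
  }

infixr 7 _□_
_□_ : Graph → Graph → Graph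
G □ H = record
  { Vertex = Vertex G × Vertex H
  ; _~_    = λ (u , v) (u′ , v′) → (u ≡ u′ × v H.~ v′) ⊎ (v ≡ v′ × u G.~ u′)
  ; ~-sym  = λ { (inj₁ (p , a)) → inj₁ (sym p , H.~-sym a)
               ; (inj₂ (p , a)) → inj₂ (sym p , G.~-sym a) }
  ; ~-irr  = λ { refl (inj₁ (_ , a)) → H.~-irr refl a
               ; refl (inj₂ (_ , a)) → G.~-irr refl a }
  }
  where
  module G = Graph G
  module H = Graph H

ladder : ℕ → Graph
ladder k = K 2 □ P k

-- G is a subdivision of H.  An edge uv of H is presented by two ordered
-- pairs, (u , v) and (v , u); interior-reverse makes both of them (and any
-- two proofs of adjacency) describe the same path of G.
record Subdivision (H G : Graph) : Set where
  private
    module H = Graph H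
    module G = Graph G
  field
    branch           : H.Vertex → G.Vertex
    branch-injective : ∀ {u v} → branch u ≡ branch v → u ≡ v

    interior         : ∀ {u v} → u H.~ v → List G.Vertex

  path : ∀ {u v} → u H.~ v → List G.Vertex
  path {u} {v} uv = branch u ∷ interior uv ∷ʳ branch v

  field
    path-linked      : ∀ {u v} (uv : u H.~ v) → Linked G._~_ (path uv)
    path-unique      : ∀ {u v} (uv : u H.~ v) → Unique (path uv)
    interior-reverse : ∀ {u v} (uv : u H.~ v) (vu : v H.~ u) →
                       interior vu ≡ reverse (interior uv)

    interior-branch  : ∀ {u v} (uv : u H.~ v) w → ¬ (branch w ∈ interior uv)
    interior-disjoint : ∀ {u v u′ v′} (uv : u H.~ v) (uv′ : u′ H.~ v′) {x} →
                        x ∈ interior uv → x ∈ interior uv′ →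
                        (u ≡ u′ × v ≡ v′) ⊎ (u ≡ v′ × v ≡ u′)

    cover-vertices   : ∀ x → (∃[ w ] x ≡ branch w) ⊎
                       (∃[ u ] ∃[ v ] Σ[ uv ∈ u H.~ v ] x ∈ interior uv)
    cover-edges      : ∀ {x y} → x G.~ y →
                       ∃[ u ] ∃[ v ] Σ[ uv ∈ u H.~ v ] ∃[ ps ] ∃[ qs ]
                         path uv ≡ ps ++ x ∷ y ∷ qs

HasCycle : Graph → ℕ → Set
HasCycle G ℓ = ∃[ x ] ∃[ xs ]
  length (x ∷ xs) ≡ ℓ × 3 ℕ.≤ ℓ × Unique (x ∷ xs) × Linked _~_ (x ∷ xs ∷ʳ x)
  where open Graph G

Λ : Graph → Pred ℕ 0ℓ
Λ G ℓ = HasCycle G ℓ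

HasCardinality : Pred ℕ 0ℓ → ℕ → Set
HasCardinality A m = ∃[ xs ] Unique xs × (∀ ℓ → A ℓ ⇔ ℓ ∈ xs) × length xs ≡ m

{-# OPTIONS --safe #-}

-- Let rung i of the subdivided ladder be at position s_i and have length r_i.  The
-- cycles are the rectangles between two rungs i < j, of length r_i + r_j + s_j - s_i.
-- With s = x - y and r = x + y this is 2 (x_j + y_i): a difference set of size k
-- gives a ladder with k rungs whose cycle lengths lie in the corresponding sumset.
-- Let x and y range over the nonnegative integer vectors in dimension d of
-- coordinate sum at most p and q, encoded as numbers in a large base.  The sums
-- number at most 2 ^ (d + p + q), whereas over all d + p + q = N the differences
-- number about (1 + √2) ^ N in total.  So some (d , p , q) has k close to
-- (1 + √2) ^ N, and then 2 ^ N ≤ k ^ α as soon as 2 < (1 + √2) ^ α.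
module Submission where

open import Data.Empty using (⊥)
open import Data.Fin.Base using (Fin; zero; suc; toℕ; fromℕ<)
open import Data.Fin.Properties using (toℕ-injective; toℕ-fromℕ<; toℕ<n)
open import Data.List.Base using (List; []; _∷_; _++_; _∷ʳ_; length; reverse; map; filter; deduplicate;
  cartesianProductWith; concatMap; allFin)
open import Data.List.Extrema.Nat using (argmax-sel; f[⊥]≤f[argmax]; f[xs]≤f[argmax])
open import Data.List.Membership.Propositional using (_∈_; find; lose)
open import Data.List.Membership.Propositional.Properties using (∈-∃++; ∈-++⁻; ∈-++⁺ˡ; ∈-++⁺ʳ; ∈-map⁺;
  ∈-filter⁺; ∈-filter⁻; ∈-deduplicate⁺; ∈-cartesianProductWith⁺; ∈-concatMap⁺; ∈-allFin)
open import Data.List.Properties using (++-assoc; length-++; reverse-++; unfold-reverse; reverse-involutive;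
  length-map; length-filter; length-deduplicate)
open import Data.List.Relation.Unary.All as All using (All; []; _∷_)
import Data.List.Relation.Unary.All.Properties as All
open import Data.List.Relation.Unary.AllPairs as AllPairs using (AllPairs; []; _∷_; allPairs?)
import Data.List.Relation.Unary.AllPairs.Properties as AllPairs
open import Data.List.Relation.Unary.Any as Any using (here; there; any?)
import Data.List.Relation.Unary.Any.Properties as Any
open import Data.List.Relation.Unary.Linked using (Linked; []; [-]; _∷_; linked?)
open import Data.List.Relation.Unary.Unique.DecPropositional.Properties using (deduplicate-!)
open import Data.List.Relation.Unary.Unique.Propositional using (Unique)
open import Data.Product.Base as Product using (_×_; _,_; ∃-syntax; proj₁; proj₂; Σ-syntax; map₁; map₂)
open import Data.Product.Properties using (≡-dec)
open import Data.Sum.Base as Sum using (_⊎_; inj₁; inj₂; [_,_]′)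
open import Function.Base using (_∘_; id)
open import Function.Bundles using (mk⇔)
open import Relation.Binary.Definitions using (tri<; tri≈; tri>; Decidable; DecidableEquality)
open import Relation.Binary.PropositionalEquality hiding ([_])
open import Relation.Nullary using (recompute)
open import Relation.Nullary.Decidable using (yes; no; Dec; map′; _×-dec_; _⊎-dec_; ¬?)
open import Relation.Nullary.Negation using (contradiction; ¬_)
open import Relation.Unary as Unary using (Pred)

-- The rungs have to be placed in the order of their differences, so the differences are listed
-- increasingly; the base N + 1 serves this, since for p + q ≤ N one unit in a digit outweighs
-- everything that the lower digits of `x` and `y` contribute together. The edges of the ladder
-- itself turn the lengths into 2 + 4 (x_j + y_i), which leaves their number unchanged. The rate 1 +
-- √2 is the dominant eigenvalue of the matrix with rows (1, 1) and (2, 1), which governs how all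
-- differences and those of either leading sign reproduce as N grows by one. No irrational number
-- enters the estimates: the hypothesis on `α` yields a rational Q / P < α and w / v ≤ √2 with 2 ^ P
-- * v ^ Q < (v + w) ^ Q. For large N this strict inequality pays for the polynomial factor lost in
-- choosing (d , p , q), and for passing from k to k - 1, as a power of a cut is bounded below
-- through rationals strictly less than its base.

-- Cycles as periodic sequences, with rotation and reversal.

module CyclicSequences where
  open import Data.Nat.Base
  open import Data.Nat.Properties
  open import Data.Nat.Tactic.RingSolver using (solve-∀)

  -- f runs around a cycle of length ℓ forever.
  record Cyclic {V : Set} (_~_ : V → V → Set) (ℓ : ℕ) (f : ℕ → V) : Set where
    field
      adj : ∀ t → f t ~ f (suc t)
      per : ∀ t → f (t + ℓ) ≡ f t
      inj : ∀ t d → d < ℓ → f (d + t) ≡ f t → d ≡ 0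

    per* : ∀ m t → f (t + m * ℓ) ≡ f t
    per* zero    t = cong f (+-identityʳ t)
    per* (suc m) t = trans (cong f (solve t m ℓ)) (trans (per (t + m * ℓ)) (per* m t))
      where
      solve : ∀ t m l → t + suc m * l ≡ t + m * l + l
      solve = solve-∀

    injective : ∀ {s t} → s < t → t < ℓ → f t ≢ f s
    injective {s} {t} s<t t<ℓ eq =
      m>n⇒m∸n≢0 s<t (inj s (t ∸ s) (≤-<-trans (m∸n≤m t s) t<ℓ)
                       (trans (cong f (m∸n+n≡m (<⇒≤ s<t))) eq))

    no-backtrack : 2 < ℓ → ∀ t → f (2 + t) ≢ f t
    no-backtrack 2<ℓ t eq with () ← inj t 2 2<ℓ eq

    wrap : f ℓ ≡ f 0
    wrap = per 0

    step< : ∀ {t} → t < ℓ → f (suc t) ≢ f 0 → suc t < ℓ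
    step< t<ℓ ne = ≤∧≢⇒< t<ℓ λ { refl → ne wrap }

    -- Time can only run into `ℓ` where `f` is back at `f 0`, so a stretch that avoids `f 0` remains
    -- within one period, where `injective` applies.
    stay : ∀ {t} → t < ℓ → ∀ n → (∀ c → c ≤ n → f (c + t) ≢ f 0) → n + t < ℓ
    stay t<ℓ zero    ne = t<ℓ
    stay t<ℓ (suc n) ne = step< (stay t<ℓ n λ c c≤n → ne c (m≤n⇒m≤1+n c≤n)) (ne (suc n) ≤-refl)

    -- A cycle of length above 2 never turns back, so a path whose inner vertices have no other
    -- neighbour on the cycle is followed to its end once it has been entered.
    run : 2 < ℓ → ∀ (g : ℕ → V) n →
          (∀ c s → suc c < n → g (suc c) ~ f s → f s ≡ g c ⊎ f s ≡ g (2 + c)) →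
          ∀ t → f t ≡ g 0 → f (suc t) ≡ g 1 →
          ∀ c → c < n → f (c + t) ≡ g c × f (suc c + t) ≡ g (suc c)
    run 2<ℓ g n forced t f0 f1 zero    c<n = f0 , f1
    run 2<ℓ g n forced t f0 f1 (suc c) c<n
      with run 2<ℓ g n forced t f0 f1 c (<-trans (n<1+n c) c<n)
    ... | fc , fc′ with forced c (2 + c + t) c<n (subst (_~ f (2 + c + t)) fc′ (adj (suc c + t)))
    ...   | inj₁ eq = contradiction (trans eq (sym fc)) (no-backtrack 2<ℓ (c + t))
    ...   | inj₂ eq = fc′ , eq

  open Cyclic

  rotate : ∀ {V : Set} {_~_ : V → V → Set} {ℓ f} → Cyclic _~_ ℓ f → ∀ a → Cyclic _~_ ℓ (λ t → f (t + a))
  rotate {ℓ = ℓ} {f} C a = record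
    { adj = λ t → adj C (t + a)
    ; per = λ t → trans (cong f (solve t ℓ a)) (per C (t + a))
    ; inj = λ t d d<ℓ eq → inj C (t + a) d d<ℓ (trans (cong f (sym (+-assoc d t a))) eq)
    }
    where
    solve : ∀ t l a → t + l + a ≡ t + a + l
    solve = solve-∀

  -- Going n steps forward on a cycle of length 1 + n is one step backward.
  reversed : ∀ {V : Set} {_~_ : V → V → Set} {n f} → (∀ {x y} → x ~ y → y ~ x) →
             Cyclic _~_ (suc n) f → Cyclic _~_ (suc n) (λ t → f (t * n))
  reversed {_~_ = _~_} {n} {f} ~-sym C = record
    { adj = λ t → ~-sym (subst (f (n + t * n) ~_)
                    (trans (cong f (solve₁ n t)) (per C (t * n))) (adj C (n + t * n)))
    ; per = λ t → trans (cong f (solve₂ n t)) (per* C n (t * n))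
    ; inj = inj′
    }
    where
    solve₁ : ∀ n t → suc (n + t * n) ≡ t * n + suc n
    solve₁ = solve-∀
    solve₂ : ∀ n t → (t + suc n) * n ≡ t * n + n * suc n
    solve₂ = solve-∀
    solve₃ : ∀ d e t → (suc d + t) * (e + d) ≡ (e + t * (e + d)) + d * suc (e + d)
    solve₃ = solve-∀
    inj′ : ∀ t d → d < suc n → f ((d + t) * n) ≡ f (t * n) → d ≡ 0
    inj′ t zero    _   _  = refl
    -- `suc d` steps backward are `n ∸ d` steps forward up to `d` full turns: (1 + d) n = (n - d) +
    -- d (1 + n).
    inj′ t (suc d) d<n eq = contradiction (inj C (t * n) (n ∸ d) (s≤s (m∸n≤m n d)) eq′)
                                          (m>n⇒m∸n≢0 (s≤s⁻¹ d<n))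
      where
      n-split : (n ∸ d) + d ≡ n
      n-split = m∸n+n≡m (<⇒≤ (s≤s⁻¹ d<n))
      eq′ : f (n ∸ d + t * n) ≡ f (t * n)
      eq′ = trans (sym (per* C d (n ∸ d + t * n)))
              (trans (cong f (sym (subst (λ k → (suc d + t) * k ≡ (n ∸ d + t * k) + d * suc k) n-split
                        (solve₃ d (n ∸ d) t)))) eq)

-- From cycles given as vertex lists to periodic sequences.

module Orbits where
  open CyclicSequences
  open import Data.Nat.Base
  open import Data.Nat.Properties

  module _ {V : Set} where

    -- Each step moves the head to the end of the list, which replaces indexing modulo the length.
    orbit : V → List V → ℕ → V
    orbit x xs       zero    = x
    orbit x []       (suc t) = x
    orbit x (y ∷ ys) (suc t) = orbit y (ys ∷ʳ x) t

    orbit-rotate : ∀ x xs y ys t → orbit x (xs ++ y ∷ ys) (suc (length xs) + t) ≡ orbit y (ys ++ x ∷ xs) t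
    orbit-rotate x []       y ys t = refl
    orbit-rotate x (z ∷ zs) y ys t = begin
      orbit z ((zs ++ y ∷ ys) ∷ʳ x) (suc (length zs) + t)  ≡⟨ cong (λ l → orbit z l (suc (length zs) + t)) (++-assoc zs (y ∷ ys) (x ∷ [])) ⟩
      orbit z (zs ++ y ∷ (ys ∷ʳ x)) (suc (length zs) + t)  ≡⟨ orbit-rotate z zs y (ys ∷ʳ x) t ⟩
      orbit y ((ys ∷ʳ x) ++ z ∷ zs) t                      ≡⟨ cong (λ l → orbit y l t) (++-assoc ys (x ∷ []) (z ∷ zs)) ⟩
      orbit y (ys ++ x ∷ z ∷ zs) t                         ∎
      where open ≡-Reasoning

    orbit-period : ∀ x xs t → orbit x xs (suc (length xs) + t) ≡ orbit x xs t
    orbit-period x []       zero    = refl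
    orbit-period x []       (suc t) = refl
    orbit-period x (y ∷ ys) t       = orbit-rotate y ys x [] t

    orbit-prefix : ∀ x xs ys {t} → t < suc (length xs) → orbit x (xs ++ ys) t ∈ x ∷ xs
    orbit-prefix x xs       ys {zero}  _  = here refl
    orbit-prefix x []       ys {suc t} (s≤s ())
    orbit-prefix x (z ∷ zs) ys {suc t} lt =
      there (subst (λ l → orbit z l t ∈ z ∷ zs) (sym (++-assoc zs ys (x ∷ []))) (orbit-prefix z zs (ys ∷ʳ x) (s≤s⁻¹ lt)))

    orbit-∈ : ∀ x xs t → orbit x xs t ∈ x ∷ xs
    orbit-∈ x xs       zero    = here refl
    orbit-∈ x []       (suc t) = here refl
    orbit-∈ x (y ∷ ys) (suc t) with orbit-∈ y (ys ∷ʳ x) t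
    ... | here eq = there (here eq)
    ... | there z∈ with ∈-++⁻ ys z∈
    ...   | inj₁ z∈ys      = there (there z∈ys)
    ...   | inj₂ (here eq) = here eq

    ∈-orbit : ∀ {y x xs} → y ∈ x ∷ xs → ∃[ t ] orbit x xs t ≡ y
    ∈-orbit (here refl) = 0 , refl
    ∈-orbit {y} {x} (there y∈) with ∈-∃++ y∈
    ... | as , bs , refl = suc (length as) + 0 , orbit-rotate x as y bs 0

    rotate-unique : ∀ {x : V} {xs : List V} → Unique (x ∷ xs) → Unique (xs ∷ʳ x)
    rotate-unique (x∉ ∷ u) = AllPairs.++⁺ u ([] ∷ []) (All.map (λ ne → (ne ∘ sym) ∷ []) x∉)

    orbit-injective : ∀ {x : V} {xs : List V} → Unique (x ∷ xs) → ∀ t d → d < suc (length xs) →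
                      orbit x xs (d + t) ≡ orbit x xs t → d ≡ 0
    orbit-injective u t zero _ _ = refl
    orbit-injective {xs = []} u t (suc d) (s≤s ()) _
    orbit-injective {x} {y ∷ ys} (x∉ ∷ _) zero (suc d) d<n eq = contradiction refl
      (All.lookup x∉ (subst (_∈ y ∷ ys) (trans (cong (orbit y (ys ∷ʳ x)) (sym (+-identityʳ d))) eq)
        (orbit-prefix y ys (x ∷ []) (s≤s⁻¹ d<n))))
    orbit-injective {x} {y ∷ ys} u (suc t) d@(suc _) d<n eq =
      orbit-injective (rotate-unique u) t d (subst (d <_) (cong suc (sym (trans (length-++ ys) (+-comm (length ys) 1)))) d<n)
        (trans (cong (orbit x (y ∷ ys)) (sym (+-suc d t))) eq)

    module _ {R : V → V → Set} where

      linked-∷ʳ : ∀ xs {x y} → Linked R (xs ∷ʳ x) → R x y → Linked R (xs ∷ʳ x ∷ʳ y)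
      linked-∷ʳ []           [-]      Rxy = Rxy ∷ [-]
      linked-∷ʳ (_ ∷ [])     (r ∷ rs) Rxy = r ∷ linked-∷ʳ [] rs Rxy
      linked-∷ʳ (_ ∷ z ∷ xs) (r ∷ rs) Rxy = r ∷ linked-∷ʳ (z ∷ xs) rs Rxy

      orbit-adjacent : ∀ {x xs} → Linked R (x ∷ xs ∷ʳ x) → ∀ t → R (orbit x xs t) (orbit x xs (suc t))
      orbit-adjacent {x} {[]}     (r ∷ _)  zero    = r
      orbit-adjacent {x} {[]}     (r ∷ _)  (suc t) = r
      orbit-adjacent {x} {y ∷ ys} (r ∷ _)  zero    = r
      orbit-adjacent {x} {y ∷ ys} (r ∷ rs) (suc t) = orbit-adjacent (linked-∷ʳ (y ∷ ys) rs r) t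

      orbit-cyclic : ∀ {W : Set} {S : W → W → Set} (g : V → W) → (∀ {x y} → g x ≡ g y → x ≡ y) →
                     (∀ {x y} → R x y → S (g x) (g y)) → ∀ {x xs} → Unique (x ∷ xs) → Linked R (x ∷ xs ∷ʳ x) →
                     Cyclic S (suc (length xs)) (λ t → g (orbit x xs t))
      orbit-cyclic g g-injective R⇒S {x} {xs} u linked = record
        { adj = λ t → R⇒S (orbit-adjacent linked t)
        ; per = λ t → cong g (trans (cong (orbit x xs) (+-comm t (suc (length xs)))) (orbit-period x xs t))
        ; inj = λ t d d<n eq → orbit-injective u t d d<n (g-injective eq)
        }

-- Every cycle of a subdivided ladder is a rectangle between two rungs.

module LadderCycles where
  open CyclicSequences
  open import Data.Nat.Base
  open import Data.Nat.Properties
  open import Data.Nat.Tactic.RingSolver using (solve-∀)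

  open Cyclic

  -- Column i of the ladder consists of the sites (i , m) with m ≤ e i: first the h i
  -- vertices that subdivide the top edge from column i - 1, then the top end of rung i,
  -- the ρ i vertices that subdivide it, and its bottom end.  Bottom edges are not subdivided.
  module LadderWalk (h ρ : ℕ → ℕ) where

    Site : Set
    Site = ℕ × ℕ

    rung : ℕ → ℕ
    rung i = suc (ρ i)

    e : ℕ → ℕ
    e i = h i + rung i

    top bottom : ℕ → Site
    top    i = i , h i
    bottom i = i , e i

    infix 4 _⟶_ _~_

    -- The edges live on all of ℕ × ℕ, with no last column and no last row; the extent of the actual
    -- ladder enters through bounds on the cycle, `col≤` and `row≤`.
    data _⟶_ : Site → Site → Set where
      vertical : ∀ {i m m′} → m′ ≡ suc m → (i , m) ⟶ (i , m′)
      along-top : ∀ {i m} → m ≡ h i → (i , m) ⟶ (suc i , 0)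
      along-bottom : ∀ {i m m′} → m ≡ e i → m′ ≡ e (suc i) → (i , m) ⟶ (suc i , m′)

    _~_ : Site → Site → Set
    x ~ y = x ⟶ y ⊎ y ⟶ x

    ~-sym : ∀ {x y} → x ~ y → y ~ x
    ~-sym = Sum.swap

    h<e : ∀ i → h i < e i
    h<e i = m<m+n (h i) z<s

    -- The edges of the top and of the bottom path between columns `a` and `n + a`, counted
    -- together: per column `1 + h` on top and 1 at the bottom.
    span : ℕ → ℕ → ℕ
    span a zero    = 0
    span a (suc n) = 2 + h (suc n + a) + span a n

    -- The neighbour of a site on the way from it to the top of the previous column
    -- (junk at (0 , 0)).
    up : Site → Site
    up (i     , suc m) = i , m
    up (suc i , zero)  = top i
    up (zero  , zero)  = 0 , 0

    -- What rung `a` cuts off on its left, including the vertices that subdivide the top edge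
    -- entering column `a` and carry its column number.
    Left : ℕ → Site → Set
    Left a (i , m) = i < a ⊎ i ≡ a × m < h a

    inner : ∀ {i m y} → (i , suc m) ~ y → suc m ≢ e i → suc m ≢ h i ⊎ proj₁ y ≢ suc i →
            y ≡ (i , m) ⊎ y ≡ (i , 2 + m)
    inner (inj₁ (vertical refl))       _  _         = inj₂ refl
    inner (inj₁ (along-top eq))        _  (inj₁ ≢h) = contradiction eq ≢h
    inner (inj₁ (along-top eq))        _  (inj₂ ≢c) = contradiction refl ≢c
    inner (inj₁ (along-bottom eq _))   ≢e _         = contradiction eq ≢e
    inner (inj₂ (vertical refl))       _  _         = inj₁ refl
    inner (inj₂ (along-bottom _ eq))   ≢e _         = contradiction eq ≢e

    at-bottom : ∀ {i m y} → m ≡ e i → (i , m) ~ y → proj₂ y ≤ e (proj₁ y) →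
                y ≡ up (i , m) ⊎ y ≡ bottom (suc i) ⊎ ∃[ i′ ] i ≡ suc i′ × y ≡ bottom i′
    at-bottom eq (inj₁ (vertical refl))         le = contradiction (≤-reflexive (sym eq)) (<⇒≱ le)
    at-bottom {i} eq (inj₁ (along-top eq′))     _  = contradiction (trans (sym eq′) eq) (<⇒≢ (h<e i))
    at-bottom _ (inj₁ (along-bottom _ refl))    _  = inj₂ (inj₁ refl)
    at-bottom _ (inj₂ (vertical refl))          _  = inj₁ refl
    at-bottom {i} eq (inj₂ (along-top _))       _  = contradiction eq (<⇒≢ (≤-<-trans z≤n (h<e i)))
    at-bottom _ (inj₂ (along-bottom refl _))    _  = inj₂ (inj₂ (_ , refl , refl))

    at-top : ∀ {i m y} → m ≡ h i → (i , m) ~ y →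
             y ≡ (i , suc m) ⊎ y ≡ (suc i , 0) ⊎ y ≡ up (i , m) × Left i y
    at-top _ (inj₁ (vertical refl))          = inj₁ refl
    at-top _ (inj₁ (along-top eq))           = inj₂ (inj₁ refl)
    at-top {i} eq (inj₁ (along-bottom eq′ _)) = contradiction (trans (sym eq) eq′) (<⇒≢ (h<e i))
    at-top eq (inj₂ (vertical refl))         = inj₂ (inj₂ (refl , inj₂ (refl , ≤-reflexive eq)))
    at-top _ (inj₂ (along-top refl))         = inj₂ (inj₂ (refl , inj₁ ≤-refl))
    at-top {i} eq (inj₂ (along-bottom _ eq′)) = contradiction (trans (sym eq) eq′) (<⇒≢ (h<e i))

    in-last : ∀ {i m y} → (i , m) ~ y → proj₁ y ≤ i →
              y ≡ (i , suc m) ⊎ (∃[ i′ ] m ≡ e i × i ≡ suc i′ × y ≡ bottom i′) ⊎ y ≡ up (i , m)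
    in-last (inj₁ (vertical refl))          _  = inj₁ refl
    in-last (inj₁ (along-top _))            le = contradiction le (<⇒≱ ≤-refl)
    in-last (inj₁ (along-bottom _ _))       le = contradiction le (<⇒≱ ≤-refl)
    in-last (inj₂ (vertical refl))          _  = inj₂ (inj₂ refl)
    in-last (inj₂ (along-top refl))         _  = inj₂ (inj₂ refl)
    in-last (inj₂ (along-bottom refl eq))   _  = inj₂ (inj₁ (_ , eq , refl , refl))

    separation : ∀ {a x y} → Left a x → x ~ y → Left a y ⊎ y ≡ top a ⊎ y ≡ bottom a
    separation (inj₁ i<a) (inj₁ (vertical _)) = inj₁ (inj₁ i<a)
    separation {a} (inj₁ i<a) (inj₁ (along-top _)) with m≤n⇒m<n∨m≡n i<a
    ... | inj₁ si<a = inj₁ (inj₁ si<a)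
    ... | inj₂ refl with m≤n⇒m<n∨m≡n (z≤n {h a})
    ...   | inj₁ 0<h = inj₁ (inj₂ (refl , 0<h))
    ...   | inj₂ 0≡h = inj₂ (inj₁ (cong (a ,_) 0≡h))
    separation (inj₁ i<a) (inj₁ (along-bottom _ refl)) with m≤n⇒m<n∨m≡n i<a
    ... | inj₁ si<a = inj₁ (inj₁ si<a)
    ... | inj₂ refl = inj₂ (inj₂ refl)
    separation (inj₁ i<a) (inj₂ (vertical _))       = inj₁ (inj₁ i<a)
    separation (inj₁ i<a) (inj₂ (along-top _))      = inj₁ (inj₁ (<-trans (n<1+n _) i<a))
    separation (inj₁ i<a) (inj₂ (along-bottom _ _)) = inj₁ (inj₁ (<-trans (n<1+n _) i<a))
    separation {a} (inj₂ (refl , m<h)) (inj₁ (vertical refl)) with m≤n⇒m<n∨m≡n m<h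
    ... | inj₁ sm<h = inj₁ (inj₂ (refl , sm<h))
    ... | inj₂ sm≡h = inj₂ (inj₁ (cong (a ,_) sm≡h))
    separation (inj₂ (refl , m<h)) (inj₁ (along-top eq)) = contradiction eq (<⇒≢ m<h)
    separation {a} (inj₂ (refl , m<h)) (inj₁ (along-bottom eq _)) =
      contradiction eq (<⇒≢ (<-trans m<h (h<e a)))
    separation (inj₂ (refl , m<h)) (inj₂ (vertical refl)) = inj₁ (inj₂ (refl , <-trans (n<1+n _) m<h))
    separation (inj₂ (refl , m<h)) (inj₂ (along-top _))      = inj₁ (inj₁ ≤-refl)
    separation (inj₂ (refl , m<h)) (inj₂ (along-bottom _ _)) = inj₁ (inj₁ ≤-refl)

    at-start : ∀ {i y} → (i , 0) ~ y → 0 ≢ h i → y ≡ (i , 1) ⊎ y ≡ up (i , 0)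
    at-start (inj₁ (vertical refl))            _  = inj₁ refl
    at-start (inj₁ (along-top eq))             ne = contradiction eq ne
    at-start {i} (inj₁ (along-bottom eq _))    _  = contradiction eq (<⇒≢ (≤-<-trans z≤n (h<e i)))
    at-start (inj₂ (along-top refl))           _  = inj₂ refl
    at-start {i} (inj₂ (along-bottom _ eq))    _  = contradiction eq (<⇒≢ (≤-<-trans z≤n (h<e i)))

    module Traversal {ℓ : ℕ} {f : ℕ → Site} (C : Cyclic _~_ ℓ f) (2<ℓ : 2 < ℓ) (j : ℕ)
                     (col≤ : ∀ t → proj₁ (f t) ≤ j)
                     (row≤ : ∀ t → proj₂ (f t) ≤ e (proj₁ (f t))) where

      next : ∀ {t x} → f t ≡ x → x ~ f (suc t)
      next {t} eq = subst (_~ f (suc t)) eq (adj C t)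

      descend : ∀ i {t m n} → n + m ≤ e i → (∀ c → suc c < n → suc c + m ≢ h i) ⊎ i ≡ j →
                f t ≡ (i , m) → f (suc t) ≡ (i , suc m) →
                ∀ c → c < n → f (c + t) ≡ (i , c + m) × f (suc c + t) ≡ (i , suc c + m)
      descend i {t} {m} {n} le ≢h f0 f1 =
        run C 2<ℓ (λ c → i , c + m) n forced t f0 f1
        where
        side : (∀ c → suc c < n → suc c + m ≢ h i) ⊎ i ≡ j →
               ∀ c s → suc c < n → suc c + m ≢ h i ⊎ proj₁ (f s) ≢ suc i
        side (inj₁ ≢h)   c s lt = inj₁ (≢h c lt)
        side (inj₂ refl) c s lt = inj₂ λ eq → <⇒≱ ≤-refl (≤-trans (≤-reflexive (sym eq)) (col≤ s))
        forced : ∀ c s → suc c < n → (i , suc c + m) ~ f s →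
                 f s ≡ (i , c + m) ⊎ f s ≡ (i , 2 + c + m)
        forced c s lt x~y =
          inner x~y (<⇒≢ (<-≤-trans (+-monoˡ-< m lt) le)) (side ≢h c s lt)

      -- No vertex of column `j` can be left to the right, so a descent there ends at `bottom j`,
      -- where only the bottom edge to the left remains.
      reach-bottom : ∀ {t m} → f t ≡ (j , m) → f (suc t) ≡ (j , suc m) →
                     ∃[ s ] ∃[ i ] j ≡ suc i × f s ≡ bottom j × f (suc s) ≡ bottom i
      reach-bottom {t} {m} ft ft′ with m<e
        where
        m<e : suc m ≤ e j
        m<e = subst (λ x → proj₂ x ≤ e (proj₁ x)) ft′ (row≤ (suc t))
      ... | m<e with m≤n⇒∃[o]m+o≡n m<e
      ...   | d , eq with descend j {n = suc d} (≤-reflexive (trans (cong suc (+-comm d m)) eq)) (inj₂ refl) ft ft′ d ≤-refl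
      ...     | fd , fd′ with at-bottom (trans (cong suc (+-comm d m)) eq) (next fd′) (row≤ (2 + d + t))
      ...       | inj₁ eq′ = contradiction (trans eq′ (sym fd)) (no-backtrack C 2<ℓ (d + t))
      ...       | inj₂ (inj₁ eq′) = contradiction (≤-trans (≤-reflexive (sym (cong proj₁ eq′))) (col≤ (2 + d + t))) (<⇒≱ ≤-refl)
      ...       | inj₂ (inj₂ (i , j≡ , eq′)) =
        suc d + t , i , j≡ , trans fd′ (cong (j ,_) (trans (cong suc (+-comm d m)) eq)) , eq′

      Result : Set
      Result = ∃[ a ] ∃[ n ] suc n + a ≡ j × ℓ ≡ rung a + rung j + span a (suc n)

      module _ (f0 : f 0 ≡ bottom j) where

        off-last : ∀ {i m t} → i ≢ j → f t ≡ (i , m) → f t ≢ f 0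
        off-last i≢j eq eq′ = i≢j (cong proj₁ (trans (sym eq) (trans eq′ f0)))

        module _ (a c : ℕ) (a+c≡j : a + c ≡ j) (1≤c : 1 ≤ c) (c<ℓ : c < ℓ)
                 (bottoms : ∀ {c′} → c′ ≤ c → f c′ ≡ bottom (j ∸ c′)) where

          a<j : a < j
          a<j = subst (a <_) a+c≡j (m<m+n a 1≤c)

          -- The moment at which the cycle is at `top (n + a)`, after `c` bottom edges, the rung `a`
          -- and the top path from column `a`.
          top-time : ℕ → ℕ
          top-time zero    = rung a + c
          top-time (suc n) = suc (h (suc n + a)) + top-time n

          -- `span` also counts one bottom edge per column, which accounts for the summand `n` on
          -- the left.
          top-time-span : ∀ n → top-time n + n ≡ rung a + c + span a n
          top-time-span zero    = refl
          top-time-span (suc n) = trans (solve₁ (h (suc n + a)) (top-time n) n)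
            (trans (cong (2 + h (suc n + a) +_) (top-time-span n)) (solve₂ (h (suc n + a)) (rung a + c) (span a n)))
            where
            solve₁ : ∀ h t n → suc h + t + suc n ≡ 2 + h + (t + n)
            solve₁ = solve-∀
            solve₂ : ∀ h r s → 2 + h + (r + s) ≡ r + (2 + h + s)
            solve₂ = solve-∀

          bottom-at : ∀ {b c′} → b + c′ ≡ j → c′ ≤ c → f c′ ≡ bottom b
          bottom-at {b} {c′} refl le = trans (bottoms le) (cong bottom (m+n∸n≡m b c′))

          -- Entering the last column forces the descent to `bottom j`, which is `f 0`. So the
          -- period is exactly `e j + suc t`.
          close : ∀ n t → suc n + a ≡ j → t ≡ top-time n → t < ℓ →
                  f t ≡ top (n + a) → f (suc t) ≡ (suc n + a , 0) → Result
          close n t eq t≡ t<ℓ ft ft′ = a , n , eq , ℓ≡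
            where
            b = n + a
            E = h j + ρ j
            e≡ : e j ≡ suc E
            e≡ = +-suc (h j) (ρ j)
            st<ℓ : suc t < ℓ
            st<ℓ = step< C t<ℓ λ eq′ → contradiction (trans (cong proj₂ (trans (sym ft′) (trans eq′ f0))) e≡) λ ()
            go : f (2 + t) ≡ (suc b , 1)
            go with in-last (next ft′) (subst (proj₁ (f (2 + t)) ≤_) (sym eq) (col≤ (2 + t)))
            ... | inj₁ eq′ = eq′
            ... | inj₂ (inj₁ (_ , 0≡e , _)) = contradiction 0≡e (<⇒≢ (≤-<-trans z≤n (h<e (suc b))))
            ... | inj₂ (inj₂ eq′) = contradiction (trans eq′ (sym ft)) (no-backtrack C 2<ℓ t)
            down : ∀ k → k < suc E → f (k + suc t) ≡ (j , k + 0) × f (suc k + suc t) ≡ (j , suc k + 0)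
            down = descend j (≤-reflexive (trans (+-identityʳ (suc E)) (sym e≡))) (inj₂ refl)
                     (trans ft′ (cong (_, 0) eq)) (trans go (cong (_, 1) eq))
            -- On the way down the rows are at most `E`, one short of `bottom j`, so the cycle does
            -- not close earlier.
            E+<ℓ : E + suc t < ℓ
            E+<ℓ = stay C st<ℓ E λ k k≤E eq′ →
              <⇒≢ (s≤s k≤E) (trans (sym (+-identityʳ k)) (trans (cong proj₂ (trans (sym (proj₁ (down k (s≤s k≤E)))) (trans eq′ f0))) e≡))
            return : f (suc E + suc t) ≡ f 0
            return = trans (proj₂ (down E ≤-refl)) (trans (cong (j ,_) (trans (+-identityʳ (suc E)) (sym e≡))) (sym f0))
            ℓ≡′ : suc E + suc t ≡ ℓ
            ℓ≡′ with m≤n⇒m<n∨m≡n E+<ℓ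
            ... | inj₁ lt = contradiction return (injective C z<s lt)
            ... | inj₂ eq′ = eq′
            c≡ : c ≡ suc n
            c≡ = +-cancelˡ-≡ a c (suc n) (trans a+c≡j (trans (sym eq) (+-comm (suc n) a)))
            solve₁ : ∀ h r t n → suc (h + r) + suc t + suc n ≡ suc (h + t) + suc n + suc r
            solve₁ = solve-∀
            solve₂ : ∀ r r′ n s → suc r + suc n + s + r′ ≡ suc r + r′ + s + suc n
            solve₂ = solve-∀
            ℓ≡ : ℓ ≡ rung a + rung j + span a (suc n)
            ℓ≡ = +-cancelʳ-≡ (suc n) ℓ _ (begin
              ℓ + suc n                              ≡⟨ cong (_+ suc n) (sym ℓ≡′) ⟩
              suc E + suc t + suc n                  ≡⟨ solve₁ (h j) (ρ j) t n ⟩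
              suc (h j + t) + suc n + rung j         ≡⟨ cong (λ k → suc (h k + t) + suc n + rung j) (sym eq) ⟩
              suc (h (suc n + a) + t) + suc n + rung j  ≡⟨ cong (λ k → suc (h (suc n + a) + k) + suc n + rung j) t≡ ⟩
              top-time (suc n) + suc n + rung j      ≡⟨ cong (_+ rung j) (top-time-span (suc n)) ⟩
              rung a + c + span a (suc n) + rung j   ≡⟨ cong (λ k → rung a + k + span a (suc n) + rung j) c≡ ⟩
              rung a + suc n + span a (suc n) + rung j ≡⟨ solve₂ (ρ a) (rung j) n (span a (suc n)) ⟩
              rung a + rung j + span a (suc n) + suc n ∎)
              where open ≡-Reasoning

          -- `H` is kept apart from `h (suc b)` so that a top edge without subdivision vertices is a
          -- case of its own: there the predecessor of `top (suc b)` is `top b`. The predecessor is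
          -- returned in order to exclude turning back afterwards.
          cross-top : ∀ b {t} H → H ≡ h (suc b) → suc b < j → t < ℓ →
                      f t ≡ top b → f (suc t) ≡ (suc b , 0) →
                      f (H + suc t) ≡ top (suc b) × f (H + t) ≡ up (suc b , H) × H + suc t < ℓ
          cross-top b {t} zero 0≡h b<j t<ℓ ft ft′ =
            trans ft′ (cong (suc b ,_) 0≡h) , ft , step< C t<ℓ (off-last (<⇒≢ b<j) ft′)
          cross-top b {t} (suc H) H≡h b<j t<ℓ ft ft′ with at-start (next ft′) (λ eq → 0≢1+n (trans eq (sym H≡h)))
          ... | inj₂ eq = contradiction (trans eq (sym ft)) (no-backtrack C 2<ℓ t)
          ... | inj₁ ft″ =
            trans (proj₂ (down H ≤-refl)) (cong (suc b ,_) (trans (+-identityʳ (suc H)) H≡h)) ,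
            trans (cong f (sym (+-suc H t))) (trans (proj₁ (down H ≤-refl)) (cong (suc b ,_) (+-identityʳ H))) ,
            stay C (step< C t<ℓ (off-last (<⇒≢ b<j) ft′)) (suc H) stays
            where
            down : ∀ k → k < suc H → f (k + suc t) ≡ (suc b , k + 0) × f (suc k + suc t) ≡ (suc b , suc k + 0)
            down = descend (suc b)
                     (≤-trans (≤-reflexive (trans (+-identityʳ (suc H)) H≡h)) (<⇒≤ (h<e (suc b))))
                     (inj₁ λ k lt eq → <⇒≢ lt (trans (sym (+-identityʳ (suc k))) (trans eq (sym H≡h)))) ft′ ft″
            stays : ∀ k → k ≤ suc H → f (k + suc t) ≢ f 0
            stays zero    _  = off-last (<⇒≢ b<j) ft′
            stays (suc k) le = off-last (<⇒≢ b<j) (proj₂ (down k le))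

          -- `k` counts the columns still to be passed before the last. At the top of such a column,
          -- going down its rung would lead to a bottom vertex already visited in the initial run to
          -- the left, so the cycle has to go on to the right.
          rightwards : ∀ k n t → suc k + n ≡ c → c ≤ t → t < ℓ → t ≡ top-time n →
                       f t ≡ top (n + a) → f (suc t) ≡ (suc n + a , 0) → Result
          rightwards zero n t eq c≤t t<ℓ t≡ ft ft′ =
            close n t (trans (+-comm (suc n) a) (trans (cong (a +_) eq) a+c≡j)) t≡ t<ℓ ft ft′
          rightwards (suc k) n t eq c≤t t<ℓ t≡ ft ft′ = continue (cross-top (n + a) (h b′) refl b′<j t<ℓ ft ft′)
            where
            b′ = suc n + a
            b′+k≡j : b′ + suc k ≡ j
            b′+k≡j = trans (solve n a k) (trans (cong (a +_) eq) a+c≡j)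
              where
              solve : ∀ n a k → suc n + a + suc k ≡ a + (suc (suc k) + n)
              solve = solve-∀
            b′<j : b′ < j
            b′<j = subst (b′ <_) b′+k≡j (m<m+n b′ z<s)
            k<c : suc k ≤ c
            k<c = subst (suc k ≤_) eq (≤-trans (n≤1+n (suc k)) (m≤m+n (2 + k) n))
            s = h b′ + suc t
            t<s : t < s
            t<s = m≤n+m (suc t) (h b′)
            continue : f s ≡ top b′ × f (h b′ + t) ≡ up (top b′) × s < ℓ → Result
            continue (fs , fs⁻ , s<ℓ) with at-top refl (next fs)
            ... | inj₁ fs⁺ = contradiction
              (trans (proj₂ (down (ρ b′) ≤-refl)) (trans (cong (b′ ,_) (+-comm (rung b′) (h b′))) (sym (bottom-at b′+k≡j k<c))))
              (injective C (≤-<-trans (≤-trans k<c c≤t) (<-≤-trans t<s (m≤n+m s (rung b′))))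
                (stay C s<ℓ (rung b′) stays))
              where
              down : ∀ k → k < rung b′ → f (k + s) ≡ (b′ , k + h b′) × f (suc k + s) ≡ (b′ , suc k + h b′)
              down = descend b′ (≤-reflexive (+-comm (rung b′) (h b′)))
                       (inj₁ λ k _ eq′ → <⇒≢ (m≤n+m (suc (h b′)) k) (sym (trans (+-suc k (h b′)) eq′))) fs fs⁺
              stays : ∀ k → k ≤ rung b′ → f (k + s) ≢ f 0
              stays zero    _  = off-last (<⇒≢ b′<j) fs
              stays (suc k) le = off-last (<⇒≢ b′<j) (proj₂ (down k le))
            ... | inj₂ (inj₁ fs⁺) =
              rightwards k (suc n) s (trans (cong suc (+-suc k n)) eq) (≤-trans c≤t (<⇒≤ t<s)) s<ℓ
                (trans (+-suc (h b′) t) (cong (λ x → suc (h b′ + x)) t≡)) fs fs⁺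
            ... | inj₂ (inj₂ (eq′ , _)) = contradiction
              (trans (cong (f ∘ suc) (sym (+-suc (h b′) t))) (trans eq′ (sym fs⁻)))
              (no-backtrack C 2<ℓ (h b′ + t))

          -- `top a` and `bottom a` separate the left part from `bottom j`, and both are already
          -- used up; a cycle that goes left here could never return to its start.
          trapped : ∀ {s} → c < s → s < ℓ → f s ≡ top a → ¬ Left a (f (suc s))
          trapped {s} c<s s<ℓ fs left with m≤n⇒∃[o]m+o≡n s<ℓ
          ... | d , eq = last (subst (Left a) (trans (cong f (trans (cong suc (+-comm d s)) eq)) (trans (wrap C) f0)) (inside d (≤-reflexive (trans (cong suc (+-comm d s)) eq))))
            where
            last : ¬ Left a (bottom j)
            last (inj₁ j<a)       = <⇒≱ a<j (<⇒≤ j<a)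
            last (inj₂ (j≡a , _)) = <⇒≢ a<j (sym j≡a)
            new : ∀ {r t m} → r < t → t ≤ ℓ → f r ≡ (a , m) → f t ≢ f r
            new r<t t≤ℓ fr with m≤n⇒m<n∨m≡n t≤ℓ
            ... | inj₁ t<ℓ  = injective C r<t t<ℓ
            ... | inj₂ refl = λ eq′ → off-last (<⇒≢ a<j) fr (trans (sym eq′) (wrap C))
            inside : ∀ d → suc d + s ≤ ℓ → Left a (f (suc d + s))
            inside zero    _  = left
            inside (suc d) le with separation (inside d (<⇒≤ le)) (adj C (suc d + s))
            ... | inj₁ l = l
            ... | inj₂ (inj₁ eq′) = contradiction (trans eq′ (sym fs)) (new (s≤s (m≤n+m s (suc d))) le fs)
            ... | inj₂ (inj₂ eq′) = contradiction (trans eq′ (sym fc)) (new (<-trans c<s (s≤s (m≤n+m s (suc d)))) le fc)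
              where
              fc : f c ≡ bottom a
              fc = bottom-at a+c≡j ≤-refl

          upwards : f (suc c) ≡ up (bottom a) → Result
          upwards fc⁺ = turn (at-top refl (next fs))
            where
            fc : f c ≡ bottom a
            fc = bottom-at a+c≡j ≤-refl
            -- Rung `a` read upwards from its bottom end, in the form that `run` expects.
            g : ℕ → Site
            g x = a , h a + (rung a ∸ x)
            g-suc : ∀ x → x < rung a → h a + (rung a ∸ x) ≡ suc (h a + (rung a ∸ suc x))
            g-suc x lt = trans (cong (h a +_) (+-∸-assoc 1 lt)) (+-suc (h a) _)
            forced : ∀ x s → suc x < rung a → g (suc x) ~ f s → f s ≡ g x ⊎ f s ≡ g (2 + x)
            forced x s lt x~y
              with inner (subst (λ m → (a , m) ~ f s) eq₁ x~y)
                     (<⇒≢ (subst (_≤ e a) (cong suc eq₁) (subst (_≤ e a) (g-suc x (<⇒≤ lt)) (+-monoʳ-≤ (h a) (m∸n≤m (rung a) x)))))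
                     (inj₁ λ eq → <⇒≢ (s≤s (m≤m+n (h a) _)) (sym eq))
              where
              eq₁ = g-suc (suc x) lt
            ... | inj₁ eq = inj₂ eq
            ... | inj₂ eq = inj₁ (trans eq (cong (a ,_) (trans (cong suc (sym (g-suc (suc x) lt))) (sym (g-suc x (<⇒≤ lt))))))
            fc⁺′ : f (suc c) ≡ g 1
            fc⁺′ = trans fc⁺ (cong up (cong (a ,_) (g-suc 0 z<s)))
            climb : ∀ x → x < rung a → f (x + c) ≡ g x × f (suc x + c) ≡ g (suc x)
            climb = run C 2<ℓ g (rung a) forced c fc fc⁺′
            s = rung a + c
            fs : f s ≡ top a
            fs = trans (proj₂ (climb (ρ a) ≤-refl)) (cong (a ,_) (trans (cong (h a +_) (n∸n≡0 (rung a))) (+-identityʳ (h a))))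
            s<ℓ : s < ℓ
            s<ℓ = stay C c<ℓ (rung a) λ where
              zero    _  → off-last (<⇒≢ a<j) fc
              (suc k) le → off-last (<⇒≢ a<j) (proj₂ (climb k le))
            c<s : c < s
            c<s = s≤s (m≤n+m c (ρ a))
            turn : f (suc s) ≡ (a , suc (h a)) ⊎ f (suc s) ≡ (suc a , 0) ⊎ f (suc s) ≡ up (top a) × Left a (f (suc s)) → Result
            turn (inj₁ eq) = contradiction
              (trans eq (sym (trans (proj₁ (climb (ρ a) ≤-refl)) (cong (a ,_)
                (trans (g-suc (ρ a) ≤-refl) (cong suc (trans (cong (h a +_) (n∸n≡0 (rung a))) (+-identityʳ (h a)))))))))
              (no-backtrack C 2<ℓ (ρ a + c))
            turn (inj₂ (inj₁ eq)) = rightwards (pred c) 0 s (trans (+-identityʳ _) (suc-pred c {{>-nonZero 1≤c}})) (<⇒≤ c<s) s<ℓ refl fs eq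
            turn (inj₂ (inj₂ (_ , left))) = contradiction left (trapped c<s s<ℓ fs)

        -- Induction on the column: at each bottom vertex the cycle either turns up the rung, which
        -- makes this rung the left side of the rectangle, or moves one column further, which is
        -- impossible at column 0.
        leftwards : ∀ a c → a + suc c ≡ j → suc c < ℓ →
                    (∀ {c′} → c′ ≤ suc c → f c′ ≡ bottom (j ∸ c′)) → Result
        leftwards a c a+c≡j c<ℓ bottoms
          with at-bottom refl (next (bottom-at a (suc c) a+c≡j z<s c<ℓ bottoms a+c≡j ≤-refl)) (row≤ (2 + c))
        ... | inj₁ eq = upwards a (suc c) a+c≡j z<s c<ℓ bottoms eq
        ... | inj₂ (inj₁ eq) = contradiction
          (trans eq (sym (bottom-at a (suc c) a+c≡j z<s c<ℓ bottoms (trans (sym (+-suc a c)) a+c≡j) (n≤1+n c))))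
          (no-backtrack C 2<ℓ c)
        leftwards (suc a) c a+c≡j c<ℓ bottoms | inj₂ (inj₂ (_ , refl , eq)) =
          leftwards a (suc c) a+c≡j′ (step< C c<ℓ (off-last a≢j eq)) bottoms′
          where
          a+c≡j′ : a + (2 + c) ≡ j
          a+c≡j′ = trans (+-suc a (suc c)) a+c≡j
          a≢j : a ≢ j
          a≢j a≡j = m+1+n≢m a (trans a+c≡j′ (sym a≡j))
          bottoms′ : ∀ {c′} → c′ ≤ 2 + c → f c′ ≡ bottom (j ∸ c′)
          bottoms′ le with m≤n⇒m<n∨m≡n le
          ... | inj₁ lt   = bottoms (s≤s⁻¹ lt)
          ... | inj₂ refl = trans eq (cong bottom (sym (trans (cong (_∸ (2 + c)) (sym a+c≡j′)) (m+n∸n≡m a (2 + c)))))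

        from-bottom : ∀ i → j ≡ suc i → f 1 ≡ bottom i → Result
        from-bottom i j≡ f1 = leftwards i 0 (trans (+-comm i 1) (sym j≡)) (<-trans (s≤s z<s) 2<ℓ) λ where
          z≤n       → f0
          (s≤s z≤n) → trans f1 (cong (bottom ∘ pred) (sym j≡))

    module _ {ℓ : ℕ} (2<ℓ : 2 < ℓ) (j : ℕ) where
      open Traversal using (Result; reach-bottom; from-bottom)

      Bounded : (ℕ → Site) → Set
      Bounded f = ∀ t → proj₁ (f t) ≤ j × proj₂ (f t) ≤ e (proj₁ (f t))

      rectangular : ∀ {f} → Cyclic _~_ ℓ f → Bounded f → ∀ {m} → f 0 ≡ (j , m) → f 1 ≢ up (j , m) →
                    ∃[ a ] ∃[ n ] suc n + a ≡ j × ℓ ≡ rung a + rung j + span a (suc n)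
      rectangular {f} C bound f0 ≢up
        with in-last (Traversal.next C 2<ℓ j (proj₁ ∘ bound) (proj₂ ∘ bound) f0) (proj₁ (bound 1))
      ... | inj₂ (inj₂ eq) = contradiction eq ≢up
      ... | inj₂ (inj₁ (i , m≡e , j≡ , f1)) =
        from-bottom C 2<ℓ j (proj₁ ∘ bound) (proj₂ ∘ bound) (trans f0 (cong (j ,_) m≡e)) i j≡ f1
      ... | inj₁ f1 with reach-bottom C 2<ℓ j (proj₁ ∘ bound) (proj₂ ∘ bound) f0 f1
      ...   | s , i , j≡ , fs , fs′ =
        from-bottom (rotate C s) 2<ℓ j (λ t → proj₁ (bound (t + s))) (λ t → proj₂ (bound (t + s))) fs i j≡ fs′

    -- The two neighbours of `f s` on the cycle differ, so at most one of them is `up (f s)`; one of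
    -- the two orientations therefore leaves `f s` otherwise, which in the rightmost column means
    -- downwards or along the bottom edge to the left.
    cycle-length : ∀ {ℓ f} → Cyclic _~_ ℓ f → 2 < ℓ → ∀ s →
                   (∀ t → proj₁ (f t) ≤ proj₁ (f s)) → (∀ t → proj₂ (f t) ≤ e (proj₁ (f t))) →
                   ∃[ a ] ∃[ n ] suc n + a ≡ proj₁ (f s) × ℓ ≡ rung a + rung (proj₁ (f s)) + span a (suc n)
    cycle-length {suc n} {f} C 2<ℓ s col≤ row≤ with ≡-dec _≟_ _≟_ (f (1 + s)) (up (f s))
    ... | no ≢up = rectangular 2<ℓ _ (rotate C s) (λ t → col≤ (t + s) , row≤ (t + s)) refl ≢up
    ... | yes ≡up = rectangular 2<ℓ _ (reversed ~-sym (rotate C s)) (λ t → col≤ (t * n + s) , row≤ (t * n + s)) refl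
      λ eq → injective (rotate C s) (s≤s⁻¹ 2<ℓ) ≤-refl
        (trans (cong (λ k → f (k + s)) (sym (*-identityˡ n))) (trans eq (sym ≡up)))

-- The subdivided ladder as a graph, and the proof that it is a subdivision.

module SubdividedLadders where
  open import Defs using (Graph; Subdivision; ladder)
  open CyclicSequences
  open LadderCycles
  open Orbits
  open import Data.Nat.Base
  open import Data.Nat.Properties

  module _ {A : Set} {R : A → A → Set} (R-sym : ∀ {x y} → R x y → R y x) where

    linked-reverse : ∀ {xs} → Linked R xs → Linked R (reverse xs)
    linked-reverse []  = []
    linked-reverse [-] = [-]
    linked-reverse (_∷_ {x} {y} {xs} Rxy rs) =
      subst (Linked R) (sym (trans (unfold-reverse x (y ∷ xs)) (cong (_∷ʳ x) (unfold-reverse y xs))))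
        (linked-∷ʳ (reverse xs) (subst (Linked R) (unfold-reverse y xs) (linked-reverse rs)) (R-sym Rxy))

  unique-reverse : ∀ {A : Set} {xs : List A} → Unique xs → Unique (reverse xs)
  unique-reverse []             = []
  unique-reverse {xs = x ∷ xs} (x∉ ∷ u) =
    subst Unique (sym (unfold-reverse x xs)) (rotate-unique {x = x} {reverse xs} (All.tabulate (λ y∈ → All.lookup x∉ (Any.reverse⁻ y∈)) ∷ unique-reverse u))

  module SubdividedLadder (h ρ : ℕ → ℕ) (h0≡0 : h 0 ≡ 0) (k : ℕ) where
    open LadderWalk h ρ hiding (top; bottom)

    -- The bounds are irrelevant fields, so a vertex is determined by its site and cycles transfer
    -- injectively to the walk on sites.
    record Vertex : Set where
      constructor vertex
      field
        column row   : ℕ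
        .column<k    : column < k
        .row≤e       : row ≤ e column
      site : Site
      site = column , row

    open Vertex

    site-injective : ∀ {x y} → site x ≡ site y → x ≡ y
    site-injective refl = refl

    ⟶-irreflexive : ∀ {x} → ¬ x ⟶ x
    ⟶-irreflexive (vertical ())

    graph : Graph
    graph = record
      { Vertex = Vertex
      ; _~_    = λ x y → site x ~ site y
      ; ~-sym  = ~-sym
      ; ~-irr  = λ { refl (inj₁ s) → ⟶-irreflexive s ; refl (inj₂ s) → ⟶-irreflexive s }
      }

    strip : ∀ i m n → .(i < k) → .(m + n ≤ suc (e i)) → List Vertex
    strip i m zero    i<k le = []
    strip i m (suc n) i<k le =
      vertex i m i<k (s≤s⁻¹ (≤-trans (m<m+n m z<s) le)) ∷
      strip i (suc m) n i<k (≤-trans (≤-reflexive (sym (+-suc m n))) le)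

    strip-∷ʳ : ∀ i m n .(i<k : i < k) .(le : m + suc n ≤ suc (e i)) .(le′ : m + n ≤ suc (e i)) .(le″ : m + n ≤ e i) →
               strip i m (suc n) i<k le ≡ strip i m n i<k le′ ∷ʳ vertex i (m + n) i<k le″
    strip-∷ʳ i m zero    i<k le le′ le″ = cong (_∷ []) (site-injective (cong (i ,_) (sym (+-identityʳ m))))
    strip-∷ʳ i m (suc n) i<k le le′ le″ = cong₂ _∷_ refl (trans
      (strip-∷ʳ i (suc m) n i<k (≤-trans (≤-reflexive (sym (+-suc m (suc n)))) le) (≤-trans (≤-reflexive (sym (+-suc m n))) le′) (≤-trans (≤-reflexive (sym (+-suc m n))) le″))
      (cong (λ v → strip i (suc m) n i<k (≤-trans (≤-reflexive (sym (+-suc m n))) le′) ∷ʳ v) (site-injective (cong (i ,_) (sym (+-suc m n))))))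

    Within : ℕ → ℕ → ℕ → Vertex → Set
    Within i m n x = column x ≡ i × m ≤ row x × row x < m + n

    strip-within : ∀ i m n .(i<k : i < k) .(le : m + n ≤ suc (e i)) → All (Within i m n) (strip i m n i<k le)
    strip-within i m zero    i<k le = []
    strip-within i m (suc n) i<k le = (refl , ≤-refl , m<m+n m z<s) ∷
      All.map (λ (c , l , u) → c , <⇒≤ l , ≤-trans u (≤-reflexive (sym (+-suc m n)))) (strip-within i (suc m) n i<k _)

    strip-unique : ∀ i m n .(i<k : i < k) .(le : m + n ≤ suc (e i)) → Unique (strip i m n i<k le)
    strip-unique i m zero    i<k le = []
    strip-unique i m (suc n) i<k le =
      All.map (λ (_ , l , _) eq → <⇒≢ l (cong row eq)) (strip-within i (suc m) n i<k _) ∷ strip-unique i (suc m) n i<k _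

    strip-linked : ∀ i m n .(i<k : i < k) .(le : m + n ≤ suc (e i)) → Linked (Graph._~_ graph) (strip i m n i<k le)
    strip-linked i m zero          i<k le = []
    strip-linked i m (suc zero)    i<k le = [-]
    strip-linked i m (suc (suc n)) i<k le = inj₁ (vertical refl) ∷ strip-linked i (suc m) (suc n) i<k (≤-trans (≤-reflexive (sym (+-suc m (suc n)))) le)

    ∈-strip : ∀ i m n .(i<k : i < k) .(le : m + n ≤ suc (e i)) x → Within i m n x → x ∈ strip i m n i<k le
    ∈-strip i m zero    i<k le x (refl , l , u) = contradiction u (≤⇒≯ (≤-trans (≤-reflexive (+-identityʳ m)) l))
    ∈-strip i m (suc n) i<k le x (refl , l , u) with m≤n⇒m<n∨m≡n l
    ... | inj₁ m<row = there (∈-strip i (suc m) n i<k _ x (refl , m<row , ≤-trans u (≤-reflexive (+-suc m n))))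
    ... | inj₂ refl = here refl

    Consecutive : Vertex → Vertex → List Vertex → Set
    Consecutive x y l = ∃[ ps ] ∃[ qs ] l ≡ ps ++ x ∷ y ∷ qs

    consecutive-∷ : ∀ {x y z l} → Consecutive x y l → Consecutive x y (z ∷ l)
    consecutive-∷ {z = z} (ps , qs , eq) = z ∷ ps , qs , cong (z ∷_) eq

    consecutive-reverse : ∀ {x y l} → Consecutive x y l → Consecutive y x (reverse l)
    consecutive-reverse {x} {y} (ps , qs , refl) = reverse qs , reverse ps , (begin
      reverse (ps ++ x ∷ y ∷ qs)              ≡⟨ reverse-++ ps (x ∷ y ∷ qs) ⟩
      reverse (x ∷ y ∷ qs) ++ reverse ps      ≡⟨ cong (_++ reverse ps) (trans (unfold-reverse x (y ∷ qs)) (cong (_∷ʳ x) (unfold-reverse y qs))) ⟩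
      (reverse qs ∷ʳ y ∷ʳ x) ++ reverse ps    ≡⟨ ++-assoc (reverse qs ∷ʳ y) (x ∷ []) (reverse ps) ⟩
      (reverse qs ∷ʳ y) ++ x ∷ reverse ps     ≡⟨ ++-assoc (reverse qs) (y ∷ []) (x ∷ reverse ps) ⟩
      reverse qs ++ y ∷ x ∷ reverse ps        ∎)
      where open ≡-Reasoning

    strip-consecutive : ∀ i m n .(i<k : i < k) .(le : m + n ≤ suc (e i)) x y → Within i m n x → Within i m n y →
                        row y ≡ suc (row x) → Consecutive x y (strip i m n i<k le)
    strip-consecutive i m zero i<k le x y (refl , l , u) _ _ = contradiction u (≤⇒≯ (≤-trans (≤-reflexive (+-identityʳ m)) l))
    strip-consecutive i m (suc n) i<k le x y (refl , l , u) (refl , l′ , u′) eq with m≤n⇒m<n∨m≡n l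
    ... | inj₁ m<row = consecutive-∷ (strip-consecutive i (suc m) n i<k _ x y
            (refl , m<row , ≤-trans u (≤-reflexive (+-suc m n)))
            (refl , ≤-trans (<⇒≤ (s≤s m<row)) (≤-reflexive (sym eq)) , ≤-trans u′ (≤-reflexive (+-suc m n))) eq)
    strip-consecutive i m (suc zero) i<k le x y _ (refl , l′ , u′) eq | inj₂ refl =
      contradiction u′ (≤⇒≯ (≤-reflexive (trans (+-comm (row x) 1) (sym eq))))
    strip-consecutive i m (suc (suc n)) i<k le x y (refl , l , u) (refl , l′ , u′) eq | inj₂ refl =
      [] , strip i (2 + row x) n i<k _ , cong₂ _∷_ refl (cong₂ _∷_ (site-injective (cong (i ,_) (sym eq))) refl)

    private
      module H = Graph (ladder k)

    branch : H.Vertex → Vertex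
    branch (zero     , i) = vertex (toℕ i) (h (toℕ i)) (toℕ<n i) (<⇒≤ (h<e (toℕ i)))
    branch (suc zero , i) = vertex (toℕ i) (e (toℕ i)) (toℕ<n i) ≤-refl

    branch-injective : ∀ {u v} → branch u ≡ branch v → u ≡ v
    branch-injective {zero , i} {zero , j} eq = cong (zero ,_) (toℕ-injective (cong column eq))
    branch-injective {suc zero , i} {suc zero , j} eq = cong (suc zero ,_) (toℕ-injective (cong column eq))
    branch-injective {zero , i} {suc zero , j} eq =
      contradiction (trans (cong row eq) (cong e (sym (cong column eq)))) (<⇒≢ (h<e (toℕ i)))
    branch-injective {suc zero , i} {zero , j} eq =
      contradiction (trans (cong row (sym eq)) (cong e (cong column eq))) (<⇒≢ (h<e (toℕ j)))

    -- One orientation per edge of the ladder. Interiors are defined in this orientation and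
    -- reversed for the other, so they do not depend on the proof of adjacency.
    data Forward : H.Vertex → H.Vertex → Set where
      top    : ∀ {i j} → suc (toℕ i) ≡ toℕ j → Forward (zero , i) (zero , j)
      bottom : ∀ {i j} → suc (toℕ i) ≡ toℕ j → Forward (suc zero , i) (suc zero , j)
      rungs  : ∀ {i} → Forward (zero , i) (suc zero , i)

    classify : ∀ {u v} → u H.~ v → Forward u v ⊎ Forward v u
    classify {zero , i}     {_ , j} (inj₁ (refl , inj₁ p)) = inj₁ (top p)
    classify {zero , i}     {_ , j} (inj₁ (refl , inj₂ p)) = inj₂ (top p)
    classify {suc zero , i} {_ , j} (inj₁ (refl , inj₁ p)) = inj₁ (bottom p)
    classify {suc zero , i} {_ , j} (inj₁ (refl , inj₂ p)) = inj₂ (bottom p)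
    classify {zero , i}     {zero , _}     (inj₂ (refl , ne)) = contradiction refl ne
    classify {zero , i}     {suc zero , _} (inj₂ (refl , ne)) = inj₁ rungs
    classify {suc zero , i} {zero , _}     (inj₂ (refl , ne)) = inj₂ rungs
    classify {suc zero , i} {suc zero , _} (inj₂ (refl , ne)) = contradiction refl ne

    edge : ∀ {u v} → Forward u v → u H.~ v
    edge (top p)    = inj₁ (refl , inj₁ p)
    edge (bottom p) = inj₁ (refl , inj₁ p)
    edge rungs      = inj₂ (refl , λ ())

    forward-asym : ∀ {u v} → Forward u v → ¬ Forward v u
    forward-asym (top p)    (top q)    = <-asym (≤-reflexive p) (≤-reflexive q)
    forward-asym (bottom p) (bottom q) = <-asym (≤-reflexive p) (≤-reflexive q)

    inside : ∀ {u v} → Forward u v → List Vertex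
    inside (top {j = j} _) = strip (toℕ j) 0 (h (toℕ j)) (toℕ<n j) (<⇒≤ (m≤n⇒m≤1+n (h<e (toℕ j))))
    inside (bottom _)      = []
    inside (rungs {i})     = strip (toℕ i) (suc (h (toℕ i))) (ρ (toℕ i)) (toℕ<n i) (s≤s (+-monoʳ-≤ (h (toℕ i)) (n≤1+n _)))

    inside-irrelevant : ∀ {u v} (F F′ : Forward u v) → inside F ≡ inside F′
    inside-irrelevant (top _)    (top _)    = refl
    inside-irrelevant (bottom _) (bottom _) = refl
    inside-irrelevant rungs      rungs      = refl

    interior : ∀ {u v} → u H.~ v → List Vertex
    interior uv = [ inside , reverse ∘ inside ]′ (classify uv)

    interior-forward : ∀ {u v} (uv : u H.~ v) (F : Forward u v) → interior uv ≡ inside F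
    interior-forward uv F with classify uv
    ... | inj₁ F′ = inside-irrelevant F′ F
    ... | inj₂ F′ = contradiction F′ (forward-asym F)

    interior-backward : ∀ {u v} (vu : v H.~ u) (F : Forward u v) → interior vu ≡ reverse (inside F)
    interior-backward vu F with classify vu
    ... | inj₁ F′ = contradiction F′ (forward-asym F)
    ... | inj₂ F′ = cong reverse (inside-irrelevant F′ F)

    interior-reverse : ∀ {u v} (uv : u H.~ v) (vu : v H.~ u) → interior vu ≡ reverse (interior uv)
    interior-reverse uv vu with classify uv
    ... | inj₁ F = interior-backward vu F
    ... | inj₂ F = trans (interior-forward vu F) (sym (reverse-involutive (inside F)))

    between : H.Vertex → List Vertex → H.Vertex → List Vertex
    between u xs v = branch u ∷ xs ∷ʳ branch v

    between-reverse : ∀ u xs v → reverse (between u xs v) ≡ between v (reverse xs) u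
    between-reverse u xs v = trans (unfold-reverse (branch u) (xs ∷ʳ branch v))
      (cong (_∷ʳ branch u) (reverse-++ xs (branch v ∷ [])))

    -- With its right end appended, the interior of a top edge is a single strip from row 0; its
    -- properties are then those of strips, plus one first step.
    top-path : ∀ {i j} (p : suc (toℕ i) ≡ toℕ j) → between (zero , i) (inside (top {i} {j} p)) (zero , j) ≡
               branch (zero , i) ∷ strip (toℕ j) 0 (suc (h (toℕ j))) (toℕ<n j) (m≤n⇒m≤1+n (h<e (toℕ j)))
    top-path {i} {j} p = cong (branch (zero , i) ∷_) (sym (strip-∷ʳ (toℕ j) 0 (h (toℕ j)) (toℕ<n j)
      (m≤n⇒m≤1+n (h<e (toℕ j))) (<⇒≤ (m≤n⇒m≤1+n (h<e (toℕ j)))) (<⇒≤ (h<e (toℕ j)))))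

    rung-bound : ∀ i → h i + (2 + ρ i) ≤ suc (e i)
    rung-bound i = ≤-reflexive (+-suc (h i) (suc (ρ i)))

    rung-path : ∀ i → between (zero , i) (inside (rungs {i})) (suc zero , i) ≡
                strip (toℕ i) (h (toℕ i)) (2 + ρ (toℕ i)) (toℕ<n i) (rung-bound (toℕ i))
    rung-path i = cong₂ _∷_ refl (trans
      (cong (inside (rungs {i}) ∷ʳ_) (site-injective (cong (c ,_) (+-suc (h c) (ρ c)))))
      (sym (strip-∷ʳ c (suc (h c)) (ρ c) (toℕ<n i) (s≤s ≤-refl) (s≤s (+-monoʳ-≤ (h c) (n≤1+n _))) (≤-reflexive (sym (+-suc (h c) (ρ c)))))))
      where c = toℕ i

    forward-linked : ∀ {u v} (F : Forward u v) → Linked (Graph._~_ graph) (between u (inside F) v)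
    forward-linked (top {i} {j} p) = subst (Linked _) (sym (top-path p))
      (subst (λ c → (toℕ i , h (toℕ i)) ~ (c , 0)) p (inj₁ (along-top refl)) ∷ strip-linked (toℕ j) 0 (suc (h (toℕ j))) (toℕ<n j) (m≤n⇒m≤1+n (h<e (toℕ j))))
    forward-linked (bottom {i} {j} p) =
      subst (λ c → (toℕ i , e (toℕ i)) ~ (c , e c)) p (inj₁ (along-bottom refl refl)) ∷ [-]
    forward-linked (rungs {i}) = subst (Linked _) (sym (rung-path i)) (strip-linked (toℕ i) (h (toℕ i)) (2 + ρ (toℕ i)) (toℕ<n i) (rung-bound (toℕ i)))

    forward-unique : ∀ {u v} (F : Forward u v) → Unique (between u (inside F) v)
    forward-unique (top {i} {j} p) = subst Unique (sym (top-path p))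
      (All.map (λ (c , _) eq → <⇒≢ (≤-reflexive p) (trans (cong column eq) c)) (strip-within (toℕ j) 0 (suc (h (toℕ j))) (toℕ<n j) (m≤n⇒m≤1+n (h<e (toℕ j))))
       ∷ strip-unique (toℕ j) 0 (suc (h (toℕ j))) (toℕ<n j) (m≤n⇒m≤1+n (h<e (toℕ j))))
    forward-unique (bottom {i} {j} p) = ((λ eq → <⇒≢ (≤-reflexive p) (cong column eq)) ∷ []) ∷ [] ∷ []
    forward-unique (rungs {i}) = subst Unique (sym (rung-path i)) (strip-unique (toℕ i) (h (toℕ i)) (2 + ρ (toℕ i)) (toℕ<n i) (rung-bound (toℕ i)))

    -- Membership in an interior as a condition on column and row, so that disjointness becomes a
    -- comparison of numbers.
    Inside : ∀ {u v} → Forward u v → Vertex → Set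
    Inside (top {j = j} _) x = column x ≡ toℕ j × row x < h (column x)
    Inside (bottom _)      x = ⊥
    Inside (rungs {i})     x = column x ≡ toℕ i × h (column x) < row x × row x < e (column x)

    ∈-inside : ∀ {u v} (F : Forward u v) {x} → x ∈ inside F → Inside F x
    ∈-inside (top {j = j} _) x∈ with All.lookup (strip-within (toℕ j) 0 (h (toℕ j)) _ _) x∈
    ... | refl , _ , lt = refl , lt
    ∈-inside (rungs {i}) x∈ with All.lookup (strip-within (toℕ i) (suc (h (toℕ i))) (ρ (toℕ i)) _ _) x∈
    ... | refl , gt , lt = refl , gt , ≤-trans lt (≤-reflexive (sym (+-suc (h (toℕ i)) (ρ (toℕ i)))))

    inside-branch : ∀ {u v} (F : Forward u v) w → ¬ Inside F (branch w)
    inside-branch (top _) (zero , i)     (_ , lt) = <-irrefl refl lt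
    inside-branch (top _) (suc zero , i) (_ , lt) = <-asym lt (h<e (toℕ i))
    inside-branch rungs   (zero , i)     (_ , lt , _) = <-irrefl refl lt
    inside-branch rungs   (suc zero , i) (_ , _ , lt) = <-irrefl refl lt

    inside-disjoint : ∀ {u v u′ v′} (F : Forward u v) (F′ : Forward u′ v′) {x} → Inside F x → Inside F′ x → u ≡ u′ × v ≡ v′
    inside-disjoint (top p) (top q) (eq , _) (eq′ , _) =
      cong (zero ,_) (toℕ-injective (suc-injective (trans p (trans (sym eq) (trans eq′ (sym q)))))) ,
      cong (zero ,_) (toℕ-injective (trans (sym eq) eq′))
    inside-disjoint (top _) rungs (_ , lt) (_ , gt , _) = contradiction gt (<-asym lt)
    inside-disjoint rungs (top _) (_ , gt , _) (_ , lt) = contradiction gt (<-asym lt)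
    inside-disjoint rungs rungs (eq , _) (eq′ , _) with toℕ-injective (trans (sym eq) eq′)
    ... | refl = refl , refl

    ∈-interior : ∀ {u v} (uv : u H.~ v) {x} → x ∈ interior uv →
                 (Σ[ F ∈ Forward u v ] Inside F x) ⊎ (Σ[ F ∈ Forward v u ] Inside F x)
    ∈-interior uv x∈ with classify uv
    ... | inj₁ F = inj₁ (F , ∈-inside F x∈)
    ... | inj₂ F = inj₂ (F , ∈-inside F (Any.reverse⁻ x∈))

    column-index : ∀ x → ∃[ i ] toℕ {k} i ≡ column x
    column-index (vertex _ _ i<k _) = fromℕ< i<k , toℕ-fromℕ< i<k

    previous-index : ∀ {i} {j : Fin k} → toℕ j ≡ suc i → ∃[ i′ ] suc (toℕ {k} i′) ≡ toℕ j
    previous-index {i} {j} eq = fromℕ< i<k , trans (cong suc (toℕ-fromℕ< i<k)) (sym eq)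
      where
      i<k : i < k
      i<k = <-trans (≤-reflexive (sym eq)) (toℕ<n j)

    row-bound : ∀ x → row x ≤ e (column x)
    row-bound (vertex i m _ m≤e) = recompute (m ≤? e i) m≤e

    -- No top edge enters column 0, and `h0≡0` ensures that no vertex there would need one.
    above-top-edge : ∀ x → row x < h (column x) → ∃[ i ] ∃[ j ] column x ≡ toℕ j × suc (toℕ {k} i) ≡ toℕ {k} j
    above-top-edge x@(vertex zero m _ _) lt = contradiction (subst (m <_) h0≡0 lt) λ ()
    above-top-edge x@(vertex (suc c) m _ _) lt with column-index x
    ... | j , j≡ with previous-index j≡
    ...   | i , i≡ = i , j , sym j≡ , i≡

    cover-vertices : ∀ x → (∃[ w ] x ≡ branch w) ⊎ (∃[ u ] ∃[ v ] Σ[ uv ∈ u H.~ v ] x ∈ interior uv)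
    cover-vertices x with column-index x | <-cmp (row x) (h (column x))
    ... | j , j≡ | tri≈ _ eq _ = inj₁ ((zero , j) , site-injective (trans (cong (column x ,_) eq) (cong (λ c → c , h c) (sym j≡))))
    ... | j , j≡ | tri< lt _ _ with above-top-edge x lt
    ...   | i , j , c≡ , p = inj₂ ((zero , i) , (zero , j) , edge (top p) ,
      ∈-strip (toℕ j) 0 (h (toℕ j)) _ _ x (c≡ , z≤n , subst (λ c → row x < h c) c≡ lt))
    cover-vertices x | j , j≡ | tri> _ _ gt with m≤n⇒m<n∨m≡n (row-bound x)
    ... | inj₂ eq = inj₁ ((suc zero , j) , site-injective (trans (cong (column x ,_) eq) (cong (λ c → c , e c) (sym j≡))))
    ... | inj₁ lt = inj₂ ((zero , j) , (suc zero , j) , edge rungs ,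
      ∈-strip (toℕ j) (suc (h (toℕ j))) (ρ (toℕ j)) _ _ x (sym j≡ , subst (λ c → h c < row x) (sym j≡) gt ,
        subst (λ c → row x < suc (h c + ρ c)) (sym j≡) (≤-trans lt (≤-reflexive (+-suc (h (column x)) (ρ (column x)))))))

    cover-forward : ∀ {x y} → site x ⟶ site y →
                    ∃[ u ] ∃[ v ] Σ[ F ∈ Forward u v ] Consecutive x y (between u (inside F) v)
    -- A vertical step that starts in a row smaller than `h i` belongs to the top edge entering
    -- column `i`, any other one to rung `i`.
    cover-forward {x} {y} (vertical {i} {m} refl) with m <? h i
    ... | yes m<h with above-top-edge x m<h
    ...   | c , j , i≡ , p = (zero , c) , (zero , j) , top p , subst (Consecutive x y) (sym (top-path p))
      (consecutive-∷ (strip-consecutive (toℕ j) 0 (suc (h (toℕ j))) (toℕ<n j) (m≤n⇒m≤1+n (h<e (toℕ j))) x y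
        (i≡ , z≤n , s≤s (<⇒≤ (subst (λ c → m < h c) i≡ m<h))) (i≡ , z≤n , s≤s (subst (λ c → m < h c) i≡ m<h)) refl))
    cover-forward {x} {y} (vertical {i} {m} refl) | no m≮h with column-index x
    ... | j , refl = (zero , j) , (suc zero , j) , rungs , subst (Consecutive x y) (sym (rung-path j))
      (strip-consecutive i (h i) (2 + ρ i) (toℕ<n j) (rung-bound i) x y
        (refl , ≮⇒≥ m≮h , ≤-trans (<⇒≤ (s≤s (row-bound y))) e<) (refl , m≤n⇒m≤1+n (≮⇒≥ m≮h) , ≤-trans (s≤s (row-bound y)) e<) refl)
      where
      e< : suc (e i) ≤ h i + (2 + ρ i)
      e< = ≤-reflexive (sym (+-suc (h i) (suc (ρ i))))
    cover-forward {x} {y} (along-top {i} refl) with column-index x | column-index y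
    ... | c , refl | j , j≡ = (zero , c) , (zero , j) , top (sym j≡) , subst (Consecutive x y) (sym (top-path (sym j≡)))
      ([] , strip (toℕ j) 1 (h (toℕ j)) (toℕ<n j) (m≤n⇒m≤1+n (h<e (toℕ j))) ,
       cong₂ _∷_ refl (cong₂ _∷_ (site-injective (cong (_, 0) j≡)) refl))
    cover-forward {x} {y} (along-bottom {i} refl refl) with column-index x | column-index y
    ... | c , refl | j , j≡ = (suc zero , c) , (suc zero , j) , bottom (sym j≡) ,
      ([] , [] , cong₂ _∷_ refl (cong₂ _∷_ (site-injective (cong (λ c → c , e c) j≡)) refl))

    subdivision : Subdivision (ladder k) graph
    subdivision = record
      { branch            = branch
      ; branch-injective  = branch-injective
      ; interior          = interior
      ; path-linked       = path-linked
      ; path-unique       = path-unique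
      ; interior-reverse  = interior-reverse
      ; interior-branch   = interior-branch
      ; interior-disjoint = interior-disjoint
      ; cover-vertices    = cover-vertices
      ; cover-edges       = cover-edges
      }
      where
      path-linked : ∀ {u v} (uv : u H.~ v) → Linked (Graph._~_ graph) (between u (interior uv) v)
      path-linked {u} {v} uv with classify uv
      ... | inj₁ F = forward-linked F
      ... | inj₂ F = subst (Linked _) (between-reverse v (inside F) u)
                       (linked-reverse (λ {x} {y} → Graph.~-sym graph {x} {y}) (forward-linked F))

      path-unique : ∀ {u v} (uv : u H.~ v) → Unique (between u (interior uv) v)
      path-unique {u} {v} uv with classify uv
      ... | inj₁ F = forward-unique F
      ... | inj₂ F = subst Unique (between-reverse v (inside F) u) (unique-reverse (forward-unique F))

      interior-branch : ∀ {u v} (uv : u H.~ v) w → ¬ (branch w ∈ interior uv)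
      interior-branch uv w w∈ with ∈-interior uv w∈
      ... | inj₁ (F , w-in) = inside-branch F w w-in
      ... | inj₂ (F , w-in) = inside-branch F w w-in

      interior-disjoint : ∀ {u v u′ v′} (uv : u H.~ v) (uv′ : u′ H.~ v′) {x} → x ∈ interior uv → x ∈ interior uv′ →
                          (u ≡ u′ × v ≡ v′) ⊎ (u ≡ v′ × v ≡ u′)
      interior-disjoint uv uv′ x∈ x∈′ with ∈-interior uv x∈ | ∈-interior uv′ x∈′
      ... | inj₁ (F , x-in) | inj₁ (F′ , x-in′) = inj₁ (inside-disjoint F F′ x-in x-in′)
      ... | inj₁ (F , x-in) | inj₂ (F′ , x-in′) = inj₂ (inside-disjoint F F′ x-in x-in′)
      ... | inj₂ (F , x-in) | inj₁ (F′ , x-in′) = inj₂ (Product.swap (inside-disjoint F F′ x-in x-in′))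
      ... | inj₂ (F , x-in) | inj₂ (F′ , x-in′) = inj₁ (Product.swap (inside-disjoint F F′ x-in x-in′))

      cover-edges : ∀ {x y} → site x ~ site y → ∃[ u ] ∃[ v ] Σ[ uv ∈ u H.~ v ] Consecutive x y (between u (interior uv) v)
      cover-edges {x} {y} (inj₁ x⟶y) with cover-forward {x} {y} x⟶y
      ... | u , v , F , cons = u , v , edge F ,
        subst (λ l → Consecutive x y (between u l v)) (sym (interior-forward (edge F) F)) cons
      cover-edges {x} {y} (inj₂ y⟶x) with cover-forward {y} {x} y⟶x
      ... | u , v , F , cons = v , u , vu ,
        subst (λ l → Consecutive x y (between v l u)) (sym (interior-backward vu F))
          (subst (Consecutive x y) (between-reverse u (inside F) v) (consecutive-reverse cons))
        where
        vu : v H.~ u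
        vu = H.~-sym (edge F)

-- Sums and ordered differences of simplices of digit vectors.

module SimplexSums where
  open import Data.Nat.Base
  open import Data.Nat.Properties
  open import Data.Nat.Tactic.RingSolver using (solve-∀)

  module Sumset (N : ℕ) where

    weight : ℕ → ℕ
    weight d = suc N ^ d

    -- Simplex d p x: x is a d-digit number in base N + 1 with digit sum at most p.
    data Simplex : ℕ → ℕ → ℕ → Set where
      empty : ∀ {p} → Simplex 0 p 0
      skip  : ∀ {d p x} → Simplex d p x → Simplex (suc d) p x
      add   : ∀ {d p x} → Simplex (suc d) p x → Simplex (suc d) (suc p) (weight d + x)

    simplex-+ : ∀ {d p q x y} → Simplex d p x → Simplex d q y → Simplex d (p + q) (x + y)
    simplex-+ empty empty = empty
    simplex-+ (skip a) (skip b) = skip (simplex-+ a b)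
    simplex-+ {suc d} {suc p} {q} {y = y} (add {x = x} a) b =
      subst (Simplex (suc d) (suc p + q)) (sym (+-assoc (weight d) x y)) (add (simplex-+ a b))
    simplex-+ {suc d} {p} {suc q} {x} a@(skip _) (add {x = y} b) =
      subst₂ (Simplex (suc d)) (sym (+-suc p q)) (solve (weight d) x y) (add (simplex-+ a b))
      where
      solve : ∀ w x y → w + (x + y) ≡ x + (w + y)
      solve = solve-∀

    -- The extreme case puts all `p` units in the leading digit; the factor `suc N` avoids the
    -- exponent d - 1.
    simplex-bound : ∀ {d p x} → Simplex d p x → x * suc N ≤ p * weight d
    simplex-bound empty = z≤n
    simplex-bound {suc d} {p} {x} (skip s) = ≤-trans (simplex-bound s)
      (*-monoʳ-≤ p (m≤n*m (weight d) (suc N)))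
    simplex-bound {suc d} {suc p} (add {x = x} s) = begin
      (weight d + x) * suc N             ≡⟨ *-distribʳ-+ (suc N) (weight d) x ⟩
      weight d * suc N + x * suc N       ≤⟨ +-mono-≤ (≤-reflexive (*-comm (weight d) (suc N))) (simplex-bound s) ⟩
      weight (suc d) + p * weight (suc d) ∎
      where open ≤-Reasoning

    simplex-<weight : ∀ {d p q x y} → p + q ≤ N → Simplex d p x → Simplex d q y → x + y < weight d
    simplex-<weight {d} {p} {q} {x} {y} p+q≤N s s′ = *-cancelʳ-< (suc N) (x + y) (weight d) (begin-strict
      (x + y) * suc N          ≡⟨ *-distribʳ-+ (suc N) x y ⟩
      x * suc N + y * suc N    ≤⟨ +-mono-≤ (simplex-bound s) (simplex-bound s′) ⟩
      p * weight d + q * weight d ≡⟨ *-distribʳ-+ (weight d) p q ⟨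
      (p + q) * weight d       ≤⟨ *-monoˡ-≤ (weight d) p+q≤N ⟩
      N * weight d             <⟨ *-monoˡ-< (weight d) {{m^n≢0 (suc N) d}} (n<1+n N) ⟩
      suc N * weight d         ≡⟨ *-comm (suc N) (weight d) ⟩
      weight d * suc N         ∎)
      where open ≤-Reasoning

    sums : ℕ → ℕ → List ℕ
    sums zero    n       = 0 ∷ []
    sums (suc d) zero    = sums d 0
    sums (suc d) (suc n) = sums d (suc n) ++ map (weight d +_) (sums (suc d) n)

    sums-complete : ∀ {d n x} → Simplex d n x → x ∈ sums d n
    sums-complete empty = here refl
    sums-complete {suc d} {zero} (skip s) = sums-complete s
    sums-complete {suc d} {suc n} (skip s) = ∈-++⁺ˡ (sums-complete s)
    sums-complete {suc d} {suc n} (add s) = ∈-++⁺ʳ (sums d (suc n)) (∈-map⁺ (weight d +_) (sums-complete s))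

    -- The recursion of `sums` is Pascal's rule: the length is the binomial coefficient of d + n
    -- over d.
    length-sums : ∀ d n → length (sums d n) ≤ 2 ^ (d + n)
    length-sums zero    n       = m^n>0 2 n
    length-sums (suc d) zero    = ≤-trans (length-sums d 0) (m≤n*m (2 ^ (d + 0)) 2)
    length-sums (suc d) (suc n) = begin
      length (sums d (suc n) ++ map (weight d +_) (sums (suc d) n))
        ≡⟨ length-++ (sums d (suc n)) ⟩
      length (sums d (suc n)) + length (map (weight d +_) (sums (suc d) n))
        ≡⟨ cong (length (sums d (suc n)) +_) (length-map (weight d +_) (sums (suc d) n)) ⟩
      length (sums d (suc n)) + length (sums (suc d) n)
        ≤⟨ +-mono-≤ (length-sums d (suc n)) (length-sums (suc d) n) ⟩
      2 ^ (d + suc n) + 2 ^ (suc d + n)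
        ≡⟨ cong (2 ^ (d + suc n) +_) (cong (2 ^_) (sym (+-suc d n))) ⟩
      2 ^ (d + suc n) + 2 ^ (d + suc n)
        ≡⟨ cong (2 ^ (d + suc n) +_) (+-identityʳ _) ⟨
      2 ^ (suc d + suc n) ∎
      where open ≤-Reasoning

    -- x − y < x′ − y′
    _≺_ : ℕ × ℕ → ℕ × ℕ → Set
    (x , y) ≺ (x′ , y′) = x + y′ < x′ + y

    -- Representatives (x , y) of the differences x − y with x, y in the simplices
    -- of size p and q, in increasing order; positive and negative are the parts of
    -- differences (suc d) in which the leading digit of x − y has the given sign.
    mutual
      differences : ℕ → ℕ → ℕ → List (ℕ × ℕ)
      differences zero    p q = (0 , 0) ∷ []
      differences (suc d) p q = negative d p q ++ differences d p q ++ positive d p q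

      positive : ℕ → ℕ → ℕ → List (ℕ × ℕ)
      positive d zero    q = []
      positive d (suc p) q = map (map₁ (weight d +_)) (differences d p q ++ positive d p q)

      negative : ℕ → ℕ → ℕ → List (ℕ × ℕ)
      negative d p zero    = []
      negative d p (suc q) = map (map₂ (weight d +_)) (negative d p q ++ differences d p q)

    -- In the signed parts only one of `x` and `y` has a leading digit, and the lower bound by
    -- `weight d` says that it is nonzero; this bound orders the parts relative to each other.
    InDifferences InPositive InNegative : ℕ → ℕ → ℕ → ℕ × ℕ → Set
    InDifferences d p q (x , y) = Simplex d p x × Simplex d q y
    InPositive    d p q (x , y) = Simplex (suc d) p x × Simplex d q y × weight d ≤ x
    InNegative    d p q (x , y) = Simplex d p x × Simplex (suc d) q y × weight d ≤ y

    mutual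
      in-differences : ∀ d p q → All (InDifferences d p q) (differences d p q)
      in-differences zero    p q = (empty , empty) ∷ []
      in-differences (suc d) p q = All.++⁺ (All.map (λ (a , b , _) → skip a , b) (in-negative d p q))
        (All.++⁺ (All.map (λ (a , b) → skip a , skip b) (in-differences d p q))
                 (All.map (λ (a , b , _) → a , skip b) (in-positive d p q)))

      in-positive : ∀ d p q → All (InPositive d p q) (positive d p q)
      in-positive d zero    q = []
      in-positive d (suc p) q = All.map⁺ (All.++⁺
        (All.map (λ {(x , _)} (a , b) → add (skip a) , b , m≤m+n (weight d) x) (in-differences d p q))
        (All.map (λ {(x , _)} (a , b , _) → add a , b , m≤m+n (weight d) x) (in-positive d p q)))

      in-negative : ∀ d p q → All (InNegative d p q) (negative d p q)
      in-negative d p zero    = []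
      in-negative d p (suc q) = All.map⁺ (All.++⁺
        (All.map (λ {(_ , y)} (a , b , _) → a , add b , m≤m+n (weight d) y) (in-negative d p q))
        (All.map (λ {(_ , y)} (a , b) → a , add (skip b) , m≤m+n (weight d) y) (in-differences d p q)))

    module _ {A : Set} {R : A → A → Set} {P Q : A → Set} where

      all-pairs-++ : (∀ {x y} → P x → Q y → R x y) → ∀ {xs ys} → All P xs → All Q ys →
                     AllPairs R xs → AllPairs R ys → AllPairs R (xs ++ ys)
      all-pairs-++ PQ⇒R ps qs rs rs′ = AllPairs.++⁺ rs rs′ (All.map (λ p → All.map (PQ⇒R p) qs) ps)

    -- One unit of weight `weight d` on the right beats all lower digits on the left, by the choice
    -- of base. It compares elements of different parts, whatever their lower digits are.
    separated : ∀ {d p q x y′} y x′ → p + q ≤ N → Simplex d p x → Simplex d q y′ →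
                weight d ≤ x′ + y → (x , y) ≺ (x′ , y′)
    separated y x′ le s s′ w≤ = <-≤-trans (simplex-<weight le s s′) w≤

    mutual
      differences-increasing : ∀ d p q → p + q ≤ N → AllPairs _≺_ (differences d p q)
      differences-increasing zero    p q le = [] ∷ []
      differences-increasing (suc d) p q le = all-pairs-++
        (λ {(x , y)} {(x′ , y′)} (a , _ , w≤) b → separated y x′ le a b (≤-trans w≤ (m≤n+m y x′)))
        (in-negative d p q)
        (All.++⁺ (All.map proj₂ (in-differences d p q)) (All.map (proj₁ ∘ proj₂) (in-positive d p q)))
        (negative-increasing d p q le)
        (upper-increasing d p q le)

      upper-increasing : ∀ d p q → p + q ≤ N → AllPairs _≺_ (differences d p q ++ positive d p q)
      upper-increasing d p q le = all-pairs-++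
        (λ {(x , y)} {(x′ , y′)} (a , _) (_ , b , w≤) → separated y x′ le a b (≤-trans w≤ (m≤m+n x′ y)))
        (in-differences d p q) (in-positive d p q) (differences-increasing d p q le) (positive-increasing d p q le)

      positive-increasing : ∀ d p q → p + q ≤ N → AllPairs _≺_ (positive d p q)
      positive-increasing d zero    q le = []
      positive-increasing d (suc p) q le = AllPairs.map⁺ (AllPairs.map
        (λ {(x , y)} {(x′ , y′)} lt → subst₂ _<_ (sym (+-assoc w x y′)) (sym (+-assoc w x′ y)) (+-monoʳ-< w lt))
        (upper-increasing d p q (<⇒≤ le)))
        where w = weight d

      negative-increasing : ∀ d p q → p + q ≤ N → AllPairs _≺_ (negative d p q)
      negative-increasing d p zero    le = []
      negative-increasing d p (suc q) le = AllPairs.map⁺ (AllPairs.map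
        (λ {(x , y)} {(x′ , y′)} lt → subst₂ _<_ (solve w x y′) (solve w x′ y) (+-monoʳ-< w lt))
        (all-pairs-++
          (λ {(x , y)} {(x′ , y′)} (a , _ , w≤) (_ , b) → separated y x′ le′ a b (≤-trans w≤ (m≤n+m y x′)))
          (in-negative d p q) (in-differences d p q) (negative-increasing d p q le′) (differences-increasing d p q le′)))
        where
        w = weight d
        le′ : p + q ≤ N
        le′ = ≤-trans (+-monoʳ-≤ p (n≤1+n q)) le
        solve : ∀ w x y → w + (x + y) ≡ x + (w + y)
        solve = solve-∀

-- The number of differences, summed over all parameters of fixed total.

module CountingDifferences where
  open SimplexSums
  open import Data.Nat.Base
  open import Data.Nat.Properties
  open import Data.Nat.Tactic.RingSolver using (solve-∀)

  -- The sum over the antidiagonal p + q = n. Raising one argument by one inside it only loses the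
  -- boundary term of the next antidiagonal.
  sum₂ : ℕ → (ℕ → ℕ → ℕ) → ℕ
  sum₂ zero    f = f 0 0
  sum₂ (suc n) f = f 0 (suc n) + sum₂ n (λ p q → f (suc p) q)

  sum₂-mono : ∀ n {f g} → (∀ p q → f p q ≤ g p q) → sum₂ n f ≤ sum₂ n g
  sum₂-mono zero    le = le 0 0
  sum₂-mono (suc n) le = +-mono-≤ (le 0 (suc n)) (sum₂-mono n (λ p → le (suc p)))

  sum₂-+ : ∀ n f g → sum₂ n (λ p q → f p q + g p q) ≡ sum₂ n f + sum₂ n g
  sum₂-+ zero    f g = refl
  sum₂-+ (suc n) f g = trans (cong (f 0 (suc n) + g 0 (suc n) +_) (sum₂-+ n (λ p → f (suc p)) (λ p → g (suc p))))
    (solve (f 0 (suc n)) (g 0 (suc n)) (sum₂ n (λ p → f (suc p))) (sum₂ n (λ p → g (suc p))))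
    where
    solve : ∀ a b c d → a + b + (c + d) ≡ a + c + (b + d)
    solve = solve-∀

  sum₂-shiftˡ : ∀ n f → sum₂ n (λ p q → f (suc p) q) ≤ sum₂ (suc n) f
  sum₂-shiftˡ n f = m≤n+m _ (f 0 (suc n))

  sum₂-shiftʳ : ∀ n f → sum₂ n (λ p q → f p (suc q)) ≤ sum₂ (suc n) f
  sum₂-shiftʳ zero    f = m≤m+n (f 0 1) (f 1 0)
  sum₂-shiftʳ (suc n) f = +-monoʳ-≤ (f 0 (2 + n)) (sum₂-shiftʳ n (λ p → f (suc p)))

  sum₂-pigeonhole : ∀ n f → ∃[ p ] ∃[ q ] p + q ≡ n × sum₂ n f ≤ suc n * f p q
  sum₂-pigeonhole zero    f = 0 , 0 , refl , m≤m+n (f 0 0) 0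
  sum₂-pigeonhole (suc n) f with sum₂-pigeonhole n (λ p → f (suc p))
  ... | p , q , p+q≡n , le with ≤-total (f 0 (suc n)) (f (suc p) q)
  ...   | inj₁ f0≤ = suc p , q , cong suc p+q≡n , +-mono-≤ f0≤ le
  ...   | inj₂ ≤f0 = 0 , suc n , refl , +-monoʳ-≤ (f 0 (suc n)) (≤-trans le (*-monoʳ-≤ (suc n) ≤f0))

  sum₃ : ℕ → (ℕ → ℕ → ℕ → ℕ) → ℕ
  sum₃ n f = sum₂ n (λ d m → sum₂ m (f d))

  sum₃-+ : ∀ n f g → sum₃ n (λ d p q → f d p q + g d p q) ≡ sum₃ n f + sum₃ n g
  sum₃-+ n f g = trans
    (≤-antisym (sum₂-mono n (λ d m → ≤-reflexive (sum₂-+ m (f d) (g d))))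
               (sum₂-mono n (λ d m → ≤-reflexive (sym (sum₂-+ m (f d) (g d))))))
    (sum₂-+ n (λ d m → sum₂ m (f d)) (λ d m → sum₂ m (g d)))

  sum₃-mono : ∀ n {f g} → (∀ d p q → f d p q ≤ g d p q) → sum₃ n f ≤ sum₃ n g
  sum₃-mono n le = sum₂-mono n (λ d m → sum₂-mono m (le d))

  sum₃-shift₁ : ∀ n f → sum₃ n (λ d p q → f (suc d) p q) ≤ sum₃ (suc n) f
  sum₃-shift₁ n f = sum₂-shiftˡ n (λ d m → sum₂ m (f d))

  sum₃-shift₂ : ∀ n f → sum₃ n (λ d p q → f d (suc p) q) ≤ sum₃ (suc n) f
  sum₃-shift₂ n f = ≤-trans (sum₂-mono n (λ d m → sum₂-shiftˡ m (f d))) (sum₂-shiftʳ n (λ d m → sum₂ m (f d)))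

  sum₃-shift₃ : ∀ n f → sum₃ n (λ d p q → f d p (suc q)) ≤ sum₃ (suc n) f
  sum₃-shift₃ n f = ≤-trans (sum₂-mono n (λ d m → sum₂-shiftʳ m (f d))) (sum₂-shiftʳ n (λ d m → sum₂ m (f d)))

  -- (n + 1)² is a crude bound for the number of triples; any polynomial would do, as it is absorbed
  -- by exponential growth.
  sum₃-pigeonhole : ∀ n f → ∃[ d ] ∃[ p ] ∃[ q ] d + (p + q) ≡ n × sum₃ n f ≤ suc n * (suc n * f d p q)
  sum₃-pigeonhole n f with sum₂-pigeonhole n (λ d m → sum₂ m (f d))
  ... | d , m , refl , le with sum₂-pigeonhole m (f d)
  ...   | p , q , refl , le′ = d , p , q , refl ,
    ≤-trans le (*-monoʳ-≤ (suc n) (≤-trans le′ (*-monoˡ-≤ (f d p q) (s≤s (m≤n+m (p + q) d)))))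

  -- Summing over all d + p + q = n, the lengths a of differences and b of positive
  -- and negative satisfy a′ ≥ a + b and b′ ≥ 2 a + b, so they grow like (1 + √2) ^ n.
  module Counting (N : ℕ) where
    open Sumset N

    #differences #positive #negative : ℕ → ℕ → ℕ → ℕ
    #differences d p q = length (differences d p q)
    #positive d p q = length (positive d p q)
    #negative d p q = length (negative d p q)

    #differences-suc : ∀ d p q → #differences (suc d) p q ≡ #negative d p q + (#differences d p q + #positive d p q)
    #differences-suc d p q = trans (length-++ (negative d p q)) (cong (#negative d p q +_) (length-++ (differences d p q)))

    #positive-suc : ∀ d p q → #positive d (suc p) q ≡ #differences d p q + #positive d p q
    #positive-suc d p q = trans (length-map _ (differences d p q ++ _)) (length-++ (differences d p q))

    #negative-suc : ∀ d p q → #negative d p (suc q) ≡ #negative d p q + #differences d p q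
    #negative-suc d p q = trans (length-map _ (negative d p q ++ _)) (length-++ (negative d p q))

    a b : ℕ → ℕ
    a n = sum₃ n #differences
    b n = sum₃ n #positive + sum₃ n #negative

    a-suc : ∀ n → a n + b n ≤ a (suc n)
    a-suc n = begin
      a n + b n
        ≡⟨ solve (a n) (sum₃ n #positive) (sum₃ n #negative) ⟩
      sum₃ n #negative + (a n + sum₃ n #positive)
        ≡⟨ cong (sum₃ n #negative +_) (sum₃-+ n #differences #positive) ⟨
      sum₃ n #negative + sum₃ n (λ d p q → #differences d p q + #positive d p q)
        ≡⟨ sum₃-+ n #negative _ ⟨
      sum₃ n (λ d p q → #negative d p q + (#differences d p q + #positive d p q))
        ≤⟨ sum₃-mono n (λ d p q → ≤-reflexive (sym (#differences-suc d p q))) ⟩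
      sum₃ n (λ d p q → #differences (suc d) p q)
        ≤⟨ sum₃-shift₁ n #differences ⟩
      a (suc n) ∎
      where
      open ≤-Reasoning
      solve : ∀ a p m → a + (p + m) ≡ m + (a + p)
      solve = solve-∀

    b-suc : ∀ n → 2 * a n + b n ≤ b (suc n)
    b-suc n = begin
      2 * a n + b n
        ≡⟨ solve (a n) (sum₃ n #positive) (sum₃ n #negative) ⟩
      (a n + sum₃ n #positive) + (sum₃ n #negative + a n)
        ≡⟨ cong₂ _+_ (sum₃-+ n #differences #positive) (sum₃-+ n #negative #differences) ⟨
      sum₃ n (λ d p q → #differences d p q + #positive d p q) + sum₃ n (λ d p q → #negative d p q + #differences d p q)
        ≤⟨ +-mono-≤ (sum₃-mono n (λ d p q → ≤-reflexive (sym (#positive-suc d p q))))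
                    (sum₃-mono n (λ d p q → ≤-reflexive (sym (#negative-suc d p q)))) ⟩
      sum₃ n (λ d p q → #positive d (suc p) q) + sum₃ n (λ d p q → #negative d p (suc q))
        ≤⟨ +-mono-≤ (sum₃-shift₂ n #positive) (sum₃-shift₃ n #negative) ⟩
      b (suc n) ∎
      where
      open ≤-Reasoning
      solve : ∀ a p m → 2 * a + (p + m) ≡ (a + p) + (m + a)
      solve = solve-∀

    module _ (v w : ℕ) (w²≤2v² : w * w ≤ 2 * (v * v)) where

      w≤2v : w ≤ 2 * v
      w≤2v with w ≤? 2 * v
      ... | yes le = le
      ... | no  ≰  = contradiction w²≤2v² (<⇒≱ (begin-strict
        2 * (v * v)         ≤⟨ m≤m+n (2 * (v * v)) (2 * (v * v)) ⟩
        2 * (v * v) + 2 * (v * v) ≡⟨ solve v ⟩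
        (2 * v) * (2 * v)   <⟨ *-mono-< (≰⇒> ≰) (≰⇒> ≰) ⟩
        w * w               ∎))
        where
        open ≤-Reasoning
        solve : ∀ v → 2 * (v * v) + 2 * (v * v) ≡ (2 * v) * (2 * v)
        solve = solve-∀

      -- With λ = 1 + w / v this reads a ≥ λ ^ n and b ≥ (w / v) λ ^ n, denominators cleared: (1 , w
      -- / v) approximates the eigenvector (1 , √2). The step for `b` needs 2 + w / v ≥ (w / v) (1 +
      -- w / v), which is (w / v)² ≤ 2.
      growth : ∀ n → (v + w) ^ n ≤ a (suc n) * v ^ n × w * (v + w) ^ n ≤ b (suc n) * v ^ suc n
      -- The induction starts at index 1, since `b 0` is 0, while `b 1` evaluates to 2.
      growth zero = z<s , (begin
        w * 1              ≡⟨ *-identityʳ w ⟩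
        w                  ≤⟨ w≤2v ⟩
        2 * v              ≡⟨ cong (2 *_) (*-identityʳ v) ⟨
        2 * (v * 1)        ∎)
        where open ≤-Reasoning
      growth (suc n) = (begin
        (v + w) * u           ≡⟨ *-distribʳ-+ u v w ⟩
        v * u + w * u         ≤⟨ +-mono-≤ (*-monoʳ-≤ v ih) ih′ ⟩
        v * (A * V) + B * (v * V) ≡⟨ solve₁ A B v V ⟩
        (A + B) * (v * V)     ≤⟨ *-monoˡ-≤ (v * V) (a-suc (suc n)) ⟩
        a (2 + n) * (v * V)   ∎) , (begin
        w * ((v + w) * u)     ≡⟨ solve₂ w v u ⟩
        w * u * v + w * w * u ≤⟨ +-mono-≤ (*-monoˡ-≤ v ih′) (*-monoˡ-≤ u w²≤2v²) ⟩
        B * (v * V) * v + 2 * (v * v) * u ≤⟨ +-monoʳ-≤ (B * (v * V) * v) (*-monoʳ-≤ (2 * (v * v)) ih) ⟩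
        B * (v * V) * v + 2 * (v * v) * (A * V) ≡⟨ solve₃ A B v V ⟩
        (2 * A + B) * (v * (v * V)) ≤⟨ *-monoˡ-≤ (v * (v * V)) (b-suc (suc n)) ⟩
        b (2 + n) * (v * (v * V)) ∎)
        where
        open ≤-Reasoning
        u = (v + w) ^ n
        V = v ^ n
        A = a (suc n)
        B = b (suc n)
        ih = proj₁ (growth n)
        ih′ = proj₂ (growth n)
        solve₁ : ∀ A B v V → v * (A * V) + B * (v * V) ≡ (A + B) * (v * V)
        solve₁ = solve-∀
        solve₂ : ∀ w v u → w * ((v + w) * u) ≡ w * u * v + w * w * u
        solve₂ = solve-∀
        solve₃ : ∀ A B v V → B * (v * V) * v + 2 * (v * v) * (A * V) ≡ (2 * A + B) * (v * (v * V))
        solve₃ = solve-∀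

      many-differences : ∀ n → ∃[ d ] ∃[ p ] ∃[ q ] d + (p + q) ≡ suc n ×
                         (v + w) ^ n ≤ (2 + n) ^ 2 * #differences d p q * v ^ n
      many-differences n with sum₃-pigeonhole (suc n) #differences
      ... | d , p , q , eq , le = d , p , q , eq ,
        ≤-trans (proj₁ (growth n)) (*-monoˡ-≤ (v ^ n) (≤-trans le (≤-reflexive (solve n (#differences d p q)))))
        where
        solve : ∀ n x → (2 + n) * ((2 + n) * x) ≡ (2 + n) * ((2 + n) * 1) * x
        solve = solve-∀

-- Integer estimates: exponential growth absorbs the polynomial loss.

module Exponents where
  open SimplexSums
  open CountingDifferences
  open import Data.Nat.Base
  open import Data.Nat.Properties
  open import Data.Nat.Tactic.RingSolver using (solve-∀)

  open Counting using (many-differences; #differences)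

  n<2^n : ∀ n → n < 2 ^ n
  n<2^n zero    = z<s
  n<2^n (suc n) = begin-strict
    suc n         ≤⟨ n<2^n n ⟩
    2 ^ n         <⟨ m<m+n (2 ^ n) (m^n>0 2 n) ⟩
    2 ^ n + 2 ^ n ≡⟨ cong (2 ^ n +_) (+-identityʳ (2 ^ n)) ⟨
    2 ^ suc n     ∎
    where open ≤-Reasoning

  ^-distribʳ-* : ∀ n x y → (x * y) ^ n ≡ x ^ n * y ^ n
  ^-distribʳ-* zero    x y = refl
  ^-distribʳ-* (suc n) x y = trans (cong (x * y *_) (^-distribʳ-* n x y)) (solve x y (x ^ n) (y ^ n))
    where
    solve : ∀ x y z w → x * y * (z * w) ≡ x * z * (y * w)
    solve = solve-∀

  ^-swap : ∀ x m n → (x ^ m) ^ n ≡ (x ^ n) ^ m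
  ^-swap x m n = trans (^-*-assoc x m n) (trans (cong (x ^_) (*-comm m n)) (sym (^-*-assoc x n m)))

  -- Bernoulli's inequality (1 + 1 / x) ^ n ≥ 1 + n / x with denominators cleared, for y at least x
  -- + 1.
  bernoulli : ∀ {x y} → x < y → ∀ n → x ^ n * (x + n) ≤ x * y ^ n
  bernoulli {x} {y} x<y zero    = ≤-reflexive (solve x)
    where
    solve : ∀ x → 1 * (x + 0) ≡ x * 1
    solve = solve-∀
  bernoulli {x} {y} x<y (suc n) = begin
    x * x ^ n * (x + suc n)          ≤⟨ m≤m+n _ (x ^ n * n) ⟩
    x * x ^ n * (x + suc n) + x ^ n * n ≡⟨ solve₁ x (x ^ n) n ⟩
    x ^ n * (x + n) * suc x          ≤⟨ *-mono-≤ (bernoulli x<y n) x<y ⟩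
    x * y ^ n * y                    ≡⟨ solve₂ x (y ^ n) y ⟩
    x * (y * y ^ n)                  ∎
    where
    open ≤-Reasoning
    solve₁ : ∀ x z n → x * z * (x + suc n) + z * n ≡ z * (x + n) * suc x
    solve₁ = solve-∀
    solve₂ : ∀ x z y → x * z * y ≡ x * (y * z)
    solve₂ = solve-∀

  doubling : ∀ x {y} .{{_ : NonZero x}} → x < y → 2 * x ^ x ≤ y ^ x
  doubling x {y} x<y = *-cancelˡ-≤ x (begin
    x * (2 * x ^ x)  ≡⟨ solve x (x ^ x) ⟩
    x ^ x * (x + x)  ≤⟨ bernoulli x<y x ⟩
    x * y ^ x        ∎)
    where
    open ≤-Reasoning
    solve : ∀ x z → x * (2 * z) ≡ z * (x + x)
    solve = solve-∀

  -- With n = x * 2 ^ (2 i), doubling gives (y / x) ^ n ≥ 2 ^ (2 ^ (2 i)).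
  exponential-beats-polynomial : ∀ x {y} .{{_ : NonZero x}} → x < y → ∀ C k n₀ →
                                 ∃[ n ] n₀ ≤ n × C * (2 + n) ^ k * x ^ n ≤ y ^ n
  exponential-beats-polynomial x {y} x<y C k n₀ = n , n₀≤n , bound
    where
    open ≤-Reasoning
    -- Chosen so that C + (2 + x + 2 i) k ≤ i (i + 1) ≤ 2 ^ (2 i): in the product with i + 1, the
    -- coefficient 4 + x covers both (2 + x) k and the term 2 i k.
    i = C + (4 + x) * k + n₀
    j = i + i
    m = 2 ^ j
    n = x * m
    n₀≤n : n₀ ≤ n
    n₀≤n = begin
      n₀   ≤⟨ m≤n+m n₀ (C + (4 + x) * k) ⟩
      i    ≤⟨ m≤m+n i i ⟩
      j    ≤⟨ <⇒≤ (n<2^n j) ⟩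
      m    ≤⟨ m≤n*m m x ⟩
      n    ∎
    exponent : C + (2 + x + j) * k ≤ m
    exponent = begin
      C + (2 + x + (i + i)) * k       ≤⟨ m≤m+n _ (C * i + (2 + x) * k * i + n₀ + n₀ * i + 2 * k) ⟩
      C + (2 + x + (i + i)) * k + (C * i + (2 + x) * k * i + n₀ + n₀ * i + 2 * k) ≡⟨ solve C x k n₀ i ⟩
      i * suc i                       ≤⟨ *-mono-≤ (<⇒≤ (n<2^n i)) (n<2^n i) ⟩
      2 ^ i * 2 ^ i                   ≡⟨ ^-distribˡ-+-* 2 i i ⟨
      m                               ∎
      where
      solve : ∀ C x k n i → C + (2 + x + (i + i)) * k + (C * i + (2 + x) * k * i + n + n * i + 2 * k) ≡ (C + (4 + x) * k + n) * suc i
      solve = solve-∀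
    base : 2 + n ≤ 2 ^ (2 + x + j)
    base = begin
      2 + x * m             ≤⟨ +-monoˡ-≤ (x * m) (m≤m*n 2 m {{m^n≢0 2 j}}) ⟩
      2 * m + x * m         ≡⟨ *-distribʳ-+ m 2 x ⟨
      (2 + x) * m           ≤⟨ *-monoˡ-≤ m (<⇒≤ (n<2^n (2 + x))) ⟩
      2 ^ (2 + x) * m       ≡⟨ ^-distribˡ-+-* 2 (2 + x) j ⟨
      2 ^ (2 + x + j)       ∎
    polynomial : C * (2 + n) ^ k ≤ 2 ^ m
    polynomial = begin
      C * (2 + n) ^ k                   ≤⟨ *-mono-≤ (<⇒≤ (n<2^n C)) (^-monoˡ-≤ k base) ⟩
      2 ^ C * (2 ^ (2 + x + j)) ^ k     ≡⟨ cong (2 ^ C *_) (^-*-assoc 2 (2 + x + j) k) ⟩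
      2 ^ C * 2 ^ ((2 + x + j) * k)     ≡⟨ ^-distribˡ-+-* 2 C _ ⟨
      2 ^ (C + (2 + x + j) * k)         ≤⟨ ^-monoʳ-≤ 2 exponent ⟩
      2 ^ m                             ∎
    bound : C * (2 + n) ^ k * x ^ n ≤ y ^ n
    bound = begin
      C * (2 + n) ^ k * x ^ n ≤⟨ *-mono-≤ polynomial (≤-reflexive (sym (^-*-assoc x x m))) ⟩
      2 ^ m * (x ^ x) ^ m     ≡⟨ ^-distribʳ-* m 2 (x ^ x) ⟨
      (2 * x ^ x) ^ m         ≤⟨ ^-monoˡ-≤ m (doubling x x<y) ⟩
      (y ^ x) ^ m             ≡⟨ ^-*-assoc y x m ⟩
      y ^ n                   ∎

  ^-cancelʳ-≤ : ∀ n .{{_ : NonZero n}} {x y} → x ^ n ≤ y ^ n → x ≤ y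
  ^-cancelʳ-≤ n {x} {y} le with x ≤? y
  ... | yes x≤y = x≤y
  ... | no  x≰y = contradiction le (<⇒≱ (^-monoˡ-< n (≰⇒> x≰y)))

  -- The Q-th power of the counting bound is compared with `beats`, and the common factor `Z`
  -- cancels.
  amplify : ∀ P Q v u s k n .{{_ : NonZero v}} .{{_ : NonZero s}} →
            u ^ n ≤ s ^ 2 * k * v ^ n →
            2 ^ P * 2 ^ Q * s ^ (2 * Q) * (2 ^ P * v ^ Q) ^ n ≤ (u ^ Q) ^ n →
            2 ^ P * 2 ^ Q * (2 ^ P) ^ n ≤ k ^ Q
  amplify P Q v u s k n many beats =
    *-cancelʳ-≤ _ _ Z {{m*n≢0 (s ^ (2 * Q)) ((v ^ Q) ^ n) {{m^n≢0 s (2 * Q)}} {{m^n≢0 (v ^ Q) n {{m^n≢0 v Q}}}}}} (begin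
      c * (2 ^ P) ^ n * Z
        ≡⟨ solve₁ c ((2 ^ P) ^ n) (s ^ (2 * Q)) ((v ^ Q) ^ n) ⟩
      c * s ^ (2 * Q) * ((2 ^ P) ^ n * (v ^ Q) ^ n)
        ≡⟨ cong (c * s ^ (2 * Q) *_) (^-distribʳ-* n (2 ^ P) (v ^ Q)) ⟨
      c * s ^ (2 * Q) * (2 ^ P * v ^ Q) ^ n
        ≤⟨ beats ⟩
      (u ^ Q) ^ n
        ≡⟨ ^-swap u Q n ⟩
      (u ^ n) ^ Q
        ≤⟨ ^-monoˡ-≤ Q many ⟩
      (s ^ 2 * k * v ^ n) ^ Q
        ≡⟨ ^-distribʳ-* Q (s ^ 2 * k) (v ^ n) ⟩
      (s ^ 2 * k) ^ Q * (v ^ n) ^ Q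
        ≡⟨ cong₂ _*_ (^-distribʳ-* Q (s ^ 2) k) (^-swap v n Q) ⟩
      (s ^ 2) ^ Q * k ^ Q * (v ^ Q) ^ n
        ≡⟨ cong (λ x → x * k ^ Q * (v ^ Q) ^ n) (^-*-assoc s 2 Q) ⟩
      s ^ (2 * Q) * k ^ Q * (v ^ Q) ^ n
        ≡⟨ solve₂ (s ^ (2 * Q)) (k ^ Q) ((v ^ Q) ^ n) ⟩
      k ^ Q * Z ∎)
    where
    open ≤-Reasoning
    c = 2 ^ P * 2 ^ Q
    Z = s ^ (2 * Q) * (v ^ Q) ^ n
    solve₁ : ∀ c a z y → c * a * (z * y) ≡ c * z * (a * y)
    solve₁ = solve-∀
    solve₂ : ∀ z k y → z * k * y ≡ k * (z * y)
    solve₂ = solve-∀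

  amplified-≥ : ∀ P Q k n n₀ .{{_ : NonZero P}} .{{_ : NonZero Q}} → n₀ * Q ≤ n →
                2 ^ P * 2 ^ Q * (2 ^ P) ^ n ≤ k ^ Q → n₀ ≤ k
  amplified-≥ P Q k n n₀ n₀Q≤n le = ≤-trans (<⇒≤ (n<2^n n₀)) (^-cancelʳ-≤ Q (begin
    (2 ^ n₀) ^ Q           ≡⟨ ^-*-assoc 2 n₀ Q ⟩
    2 ^ (n₀ * Q)           ≤⟨ ^-monoʳ-≤ 2 (≤-trans n₀Q≤n (m≤n*m n P)) ⟩
    2 ^ (P * n)            ≡⟨ ^-*-assoc 2 P n ⟨
    (2 ^ P) ^ n            ≤⟨ m≤n*m ((2 ^ P) ^ n) (2 ^ P * 2 ^ Q) {{m*n≢0 (2 ^ P) (2 ^ Q) {{m^n≢0 2 P}} {{m^n≢0 2 Q}}}} ⟩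
    2 ^ P * 2 ^ Q * (2 ^ P) ^ n ≤⟨ le ⟩
    k ^ Q                  ∎))
    where open ≤-Reasoning

  -- The hypothesis is 2 < (1 + w / v) ^ (Q / P) in integers; the conclusion says that 2 ^ n is at
  -- most the (Q / P)-th power of half the number of differences.
  sparse : ∀ P Q v w .{{_ : NonZero P}} .{{_ : NonZero Q}} .{{_ : NonZero v}} → w * w ≤ 2 * (v * v) →
           2 ^ P * v ^ Q < (v + w) ^ Q → ∀ n₀ →
           ∃[ n ] ∃[ d ] ∃[ p ] ∃[ q ] d + (p + q) ≡ n ×
           n₀ ≤ #differences n d p q × (2 ^ n) ^ P * 2 ^ Q ≤ #differences n d p q ^ Q
  sparse P Q v w w²≤2v² lt n₀ = large (exponential-beats-polynomial x {{x≢0}} lt C (2 * Q) (n₀ * Q))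
    where
    x = 2 ^ P * v ^ Q
    -- `2 ^ P` raises the exponent from `n` to `suc n`, and `2 ^ Q` provides the halving of the
    -- number of differences.
    C = 2 ^ P * 2 ^ Q
    x≢0 = m*n≢0 (2 ^ P) (v ^ Q) {{m^n≢0 2 P}} {{m^n≢0 v Q}}
    rearrange : ∀ n → (2 ^ suc n) ^ P * 2 ^ Q ≡ C * (2 ^ P) ^ n
    rearrange n = trans (cong (_* 2 ^ Q) (^-swap 2 (suc n) P)) (solve (2 ^ P) ((2 ^ P) ^ n) (2 ^ Q))
      where
      solve : ∀ a b c → a * b * c ≡ a * c * b
      solve = solve-∀
    large : (∃[ n ] n₀ * Q ≤ n × C * (2 + n) ^ (2 * Q) * x ^ n ≤ ((v + w) ^ Q) ^ n) →
            ∃[ n ] ∃[ d ] ∃[ p ] ∃[ q ] d + (p + q) ≡ n ×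
            n₀ ≤ #differences n d p q × (2 ^ n) ^ P * 2 ^ Q ≤ #differences n d p q ^ Q
    -- The count holds in every base. The base parameter is set to `suc n` because d + (p + q) ≡ suc
    -- n then gives the condition p + q ≤ N against carries.
    large (n , n₀Q≤n , beats) = conclude (many-differences (suc n) v w w²≤2v² n)
      where
      conclude : (∃[ d ] ∃[ p ] ∃[ q ] d + (p + q) ≡ suc n × (v + w) ^ n ≤ (2 + n) ^ 2 * #differences (suc n) d p q * v ^ n) → _
      conclude (d , p , q , eq , many) = suc n , d , p , q , eq ,
        amplified-≥ P Q _ n n₀ n₀Q≤n main , ≤-trans (≤-reflexive (rearrange n)) main
        where
        main : C * (2 ^ P) ^ n ≤ #differences (suc n) d p q ^ Q
        main = amplify P Q v (v + w) (2 + n) (#differences (suc n) d p q) n many beats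

-- From the hypothesis on `α` to an integer inequality, and back to a real power.

module RealExponents where
  open import Defs using (Below; Above; _^ℕ_; _^ℚ_; e; log; fromℕ; √_; _÷_)
  import Defs
  open import Algebra.Bundles using (CommutativeRing)
  import Algebra.Properties.CommutativeSemiring.Exp as Exp
  import Data.Integer.Base as ℤ
  import Data.Integer.Properties as ℤ
  open import Data.Integer.Base using (ℤ; +_; -[1+_]; +<+)
  open import Data.Nat.Base as ℕ using (ℕ; zero; suc; z≤n; s≤s)
  import Data.Nat.Properties as ℕ
  open import Data.Nat.Tactic.RingSolver using (solve-∀)
  import Data.Nat.Coprimality as ℕ
  open import Data.Rational.Base hiding (_÷_)
  open import Data.Rational.Properties
  open import Data.Rational.Unnormalised.Base as ℚᵘ using (mkℚᵘ; *≡*; *<*)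
  import Data.Rational.Unnormalised.Properties as ℚᵘ

  open Exp (CommutativeRing.commutativeSemiring +-*-commutativeRing) using (^-assocʳ; ^-distrib-*)

  1≥0 : 0ℚ ≤ 1ℚ
  1≥0 = *≤* (ℤ.+≤+ z≤n)

  0≤* : ∀ {p q} → 0ℚ ≤ p → 0ℚ ≤ q → 0ℚ ≤ p * q
  0≤* {p} {q} p≥0 q≥0 =
    nonNegative⁻¹ (p * q) {{nonNeg*nonNeg⇒nonNeg p {{nonNegative p≥0}} q {{nonNegative q≥0}}}}

  *-mono-≤ : ∀ {p q r s} → 0ℚ ≤ r → 0ℚ ≤ p → p ≤ q → r ≤ s → p * r ≤ q * s
  *-mono-≤ {p} {q} {r} {s} r≥0 p≥0 p≤q r≤s =
    ≤-trans (*-monoʳ-≤-nonNeg r {{nonNegative r≥0}} p≤q) (*-monoˡ-≤-nonNeg q {{nonNegative (≤-trans p≥0 p≤q)}} r≤s)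

  0≤^ : ∀ n {p} → 0ℚ ≤ p → 0ℚ ≤ p ^ℕ n
  0≤^ zero    _   = 1≥0
  0≤^ (suc n) p≥0 = 0≤* p≥0 (0≤^ n p≥0)

  ^-mono-≤ : ∀ n {p q} → 0ℚ ≤ p → p ≤ q → p ^ℕ n ≤ q ^ℕ n
  ^-mono-≤ zero    _   _   = ≤-refl
  ^-mono-≤ (suc n) p≥0 p≤q = *-mono-≤ (0≤^ n p≥0) p≥0 p≤q (^-mono-≤ n p≥0 p≤q)

  0<^ : ∀ n {p} → 0ℚ < p → 0ℚ < p ^ℕ n
  0<^ zero    _ = *<* (+<+ (s≤s z≤n))
  0<^ (suc n) {p} p>0 = positive⁻¹ _ {{pos*pos⇒pos p {{positive p>0}} (p ^ℕ n) {{positive (0<^ n p>0)}}}}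

  ^-mono-< : ∀ n {p q} → 0ℚ ≤ p → p < q → p ^ℕ suc n < q ^ℕ suc n
  ^-mono-< n {p} {q} p≥0 p<q = ≤-<-trans
    (*-monoˡ-≤-nonNeg p {{nonNegative p≥0}} (^-mono-≤ n p≥0 (<⇒≤ p<q)))
    (*-monoˡ-<-pos (q ^ℕ n) {{positive (0<^ n (≤-<-trans p≥0 p<q))}} p<q)

  ^-cancel-< : ∀ n {p q} → 0ℚ ≤ q → p ^ℕ n < q ^ℕ n → p < q
  ^-cancel-< n {p} {q} q≥0 lt with p <? q
  ... | yes p<q = p<q
  ... | no  p≮q = contradiction (<-≤-trans lt (^-mono-≤ n q≥0 (≮⇒≥ p≮q))) (<-irrefl refl)

  1≤^ : ∀ n {p} → 1ℚ ≤ p → 1ℚ ≤ p ^ℕ n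
  1≤^ zero    _   = ≤-refl
  1≤^ (suc n) {p} 1≤p = *-mono-≤ 1≥0 1≥0 1≤p (1≤^ n 1≤p)

  ^≤1 : ∀ n {p} → 0ℚ ≤ p → p ≤ 1ℚ → p ^ℕ n ≤ 1ℚ
  ^≤1 zero    _   _   = ≤-refl
  ^≤1 (suc n) p≥0 p≤1 = *-mono-≤ (0≤^ n p≥0) p≥0 p≤1 (^≤1 n p≥0 p≤1)

  ^-monoʳ-≤ : ∀ {p m n} → 1ℚ ≤ p → m ℕ.≤ n → p ^ℕ m ≤ p ^ℕ n
  ^-monoʳ-≤ {n = n} 1≤p z≤n       = 1≤^ n 1≤p
  ^-monoʳ-≤ {p}     1≤p (s≤s m≤n) = *-monoˡ-≤-nonNeg p {{nonNegative (≤-trans 1≥0 1≤p)}} (^-monoʳ-≤ 1≤p m≤n)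

  -- Given in normal form, so that numerator and denominator are visible without evaluating the
  -- normalisation in `+ n / 1`.
  ι : ℕ → ℚ
  ι n = mkℚ (+ n) 0 (ℕ.sym (ℕ.1-coprimeTo n))

  ι≡/1 : ∀ n → ι n ≡ + n / 1
  ι≡/1 n = sym (↥p/↧p≡p (ι n))

  ι-mono-< : ∀ {m n} → m ℕ.< n → ι m < ι n
  ι-mono-< {m} {n} lt = *<* (subst₂ ℤ._<_ (sym (ℤ.*-identityʳ (+ m))) (sym (ℤ.*-identityʳ (+ n))) (+<+ lt))

  ι-cancel-< : ∀ {m n} → ι m < ι n → m ℕ.< n
  ι-cancel-< {m} {n} (*<* lt) = ℤ.drop‿+<+ (subst₂ ℤ._<_ (ℤ.*-identityʳ (+ m)) (ℤ.*-identityʳ (+ n)) lt)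

  ι-mono-≤ : ∀ {m n} → m ℕ.≤ n → ι m ≤ ι n
  ι-mono-≤ {m} {n} le = *≤* (subst₂ ℤ._≤_ (sym (ℤ.*-identityʳ (+ m))) (sym (ℤ.*-identityʳ (+ n))) (ℤ.+≤+ le))

  ι-cancel-≤ : ∀ {m n} → ι m ≤ ι n → m ℕ.≤ n
  ι-cancel-≤ {m} {n} (*≤* le) = ℤ.drop‿+≤+ (subst₂ ℤ._≤_ (ℤ.*-identityʳ (+ m)) (ℤ.*-identityʳ (+ n)) le)

  0≤ι : ∀ n → 0ℚ ≤ ι n
  0≤ι n = ι-mono-≤ z≤n

  ι-* : ∀ m n → ι (m ℕ.* n) ≡ ι m * ι n
  ι-* m n = trans (ι≡/1 (m ℕ.* n)) (cong (_/ 1) (ℤ.pos-* m n))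

  ι-+ : ∀ m n → ι (m ℕ.+ n) ≡ ι m + ι n
  ι-+ m n = trans (ι≡/1 (m ℕ.+ n)) (cong (_/ 1) (cong₂ ℤ._+_ (sym (ℤ.*-identityʳ (+ m))) (sym (ℤ.*-identityʳ (+ n)))))

  ι-^ : ∀ m n → ι (m ℕ.^ n) ≡ ι m ^ℕ n
  ι-^ m zero    = refl
  ι-^ m (suc n) = trans (ι-* m (m ℕ.^ n)) (cong (ι m *_) (ι-^ m n))

  clear-denominator : ∀ u v-1 .(c : ℕ.Coprime u (suc v-1)) → mkℚ (+ u) v-1 c * ι (suc v-1) ≡ ι u
  clear-denominator u v-1 c = toℚᵘ-injective (ℚᵘ.≃-trans (toℚᵘ-homo-* (mkℚ (+ u) v-1 c) (ι (suc v-1)))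
    (*≡* (trans (ℤ.*-assoc (+ u) (+ suc v-1) (+ 1)) (cong (λ k → + u ℤ.* k)
      (trans (sym (ℤ.pos-* (suc v-1) 1)) refl)))))

  ^-swap : ∀ p m n → (p ^ℕ m) ^ℕ n ≡ (p ^ℕ n) ^ℕ m
  ^-swap p m n = trans (^-assocʳ p m n) (trans (cong (p ^ℕ_) (ℕ.*-comm m n)) (sym (^-assocʳ p n m)))

  1<2 : 1ℚ < ι 2
  1<2 = ι-mono-< ℕ.≤-refl

  1≤2 : 1ℚ ≤ ι 2
  1≤2 = <⇒≤ 1<2

  -- If 2 < e ^ (a / b), e ^ (c / d) < z and a / b < (Q / P) (c / d), then 2 < z ^ (Q / P).
  compare-exponents : ∀ {s t z} a b c d P Q → 0ℚ ≤ s → s ≤ t → 1ℚ ≤ t → 0ℚ ≤ z →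
                      ι 2 ^ℕ b < s ^ℕ a → t ^ℕ suc c < z ^ℕ d → a ℕ.* (suc P ℕ.* d) ℕ.≤ Q ℕ.* suc c ℕ.* b →
                      ι 2 ^ℕ suc P < z ^ℕ Q
  compare-exponents {s} {t} {z} a b c d P Q s≥0 s≤t 1≤t z≥0 2<s t<z le =
    ^-cancel-< (b ℕ.* suc c) (0≤^ Q z≥0) (begin-strict
      (ι 2 ^ℕ suc P) ^ℕ (b ℕ.* suc c)      ≡⟨ ^-swap (ι 2) (suc P) (b ℕ.* suc c) ⟩
      (ι 2 ^ℕ (b ℕ.* suc c)) ^ℕ suc P      ≡⟨ cong (_^ℕ suc P) (^-assocʳ (ι 2) b (suc c)) ⟨
      ((ι 2 ^ℕ b) ^ℕ suc c) ^ℕ suc P       <⟨ ^-mono-< P (0≤^ (suc c) (0≤^ b (0≤ι 2))) (^-mono-< c (0≤^ b (0≤ι 2)) 2<s) ⟩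
      ((s ^ℕ a) ^ℕ suc c) ^ℕ suc P         ≡⟨ cong (_^ℕ suc P) (^-swap s a (suc c)) ⟩
      ((s ^ℕ suc c) ^ℕ a) ^ℕ suc P         ≤⟨ ^-mono-≤ (suc P) (0≤^ a (0≤^ (suc c) s≥0))
                                                 (^-mono-≤ a (0≤^ (suc c) s≥0) (^-mono-≤ (suc c) s≥0 s≤t)) ⟩
      ((t ^ℕ suc c) ^ℕ a) ^ℕ suc P         ≤⟨ ^-mono-≤ (suc P) (0≤^ a t^≥0) (^-mono-≤ a t^≥0 (<⇒≤ t<z)) ⟩
      ((z ^ℕ d) ^ℕ a) ^ℕ suc P             ≡⟨ trans (cong (_^ℕ suc P) (^-assocʳ z d a)) (^-assocʳ z (d ℕ.* a) (suc P)) ⟩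
      z ^ℕ (d ℕ.* a ℕ.* suc P)             ≤⟨ ^-monoʳ-≤ 1≤z (subst₂ ℕ._≤_ (solve₁ a (suc P) d) (solve₂ Q (suc c) b) le) ⟩
      z ^ℕ (Q ℕ.* (b ℕ.* suc c))           ≡⟨ ^-assocʳ z Q (b ℕ.* suc c) ⟨
      (z ^ℕ Q) ^ℕ (b ℕ.* suc c)            ∎)
    where
    open ≤-Reasoning
    t^≥0 : 0ℚ ≤ t ^ℕ suc c
    t^≥0 = 0≤^ (suc c) (≤-trans 1≥0 1≤t)
    1≤z : 1ℚ ≤ z
    1≤z with z <? 1ℚ
    ... | no  z≮1 = ≮⇒≥ z≮1
    ... | yes z<1 = contradiction (<-≤-trans (≤-<-trans (1≤^ (suc c) 1≤t) t<z) (^≤1 d z≥0 (<⇒≤ z<1))) (<-irrefl refl)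
    solve₁ : ∀ a P d → a ℕ.* (P ℕ.* d) ≡ d ℕ.* a ℕ.* P
    solve₁ = solve-∀
    solve₂ : ∀ Q c b → Q ℕ.* c ℕ.* b ≡ Q ℕ.* (b ℕ.* c)
    solve₂ = solve-∀

  Above-e⇒1< : ∀ {t} → Above e t → 1ℚ < t
  Above-e⇒1< (r , r<t , bound) = ≤-<-trans (bound 0) r<t

  Below-e<Above-e : ∀ {s t} → Below e s → Above e t → s < t
  Below-e<Above-e (n , s<) (r , r<t , bound) = <-trans s< (≤-<-trans (bound n) r<t)

  -- For r ≤ 0 the witnesses would place a product of numbers ≥ 1 strictly below `s ^ 0`, so `r` has
  -- a positive numerator.
  Above-log-2 : ∀ r → Above (log (fromℕ 2)) r →
                ∃[ a ] ↥ r ≡ + suc a × ∃[ s ] Below e s × 0ℚ < s × ι 2 ^ℕ ↧ₙ r < s ^ℕ suc a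
  Above-log-2 r (q , 2<q , inj₁ q≤0) = contradiction (<-≤-trans 2<q q≤0) λ where (*<* (+<+ ()))
  Above-log-2 r@(mkℚ n b-1 _) (q , 2<q , inj₂ (s , t , es , s>0 , et , lt)) = by-sign n refl
    where
    1≤q^b : 1ℚ ≤ q ^ℕ suc b-1
    1≤q^b = 1≤^ (suc b-1) (≤-trans 1≤2 (<⇒≤ 2<q))
    1≤ : ∀ x → 1ℚ ≤ q ^ℕ suc b-1 * t ^ℕ x
    1≤ x = *-mono-≤ 1≥0 1≥0 1≤q^b (1≤^ x (<⇒≤ (Above-e⇒1< et)))
    by-sign : ∀ m → n ≡ m → ∃[ a ] n ≡ + suc a × ∃[ s ] Below e s × 0ℚ < s × ι 2 ^ℕ suc b-1 < s ^ℕ suc a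
    by-sign (+ suc a)  refl = a , refl , s , es , s>0 ,
      <-trans (^-mono-< b-1 (0≤ι 2) 2<q) (subst (_< s ^ℕ suc a) (*-identityʳ _) lt)
    by-sign (+ zero)   refl = contradiction (<-≤-trans lt (1≤ 0)) (<-irrefl refl)
    by-sign (-[1+ a ]) refl = contradiction (<-≤-trans lt (1≤ (suc a))) (<-irrefl refl)

  Below-log : ∀ x s → 0ℚ < s → Below (log x) s →
              ∃[ c ] ↥ s ≡ + suc c × ∃[ t ] ∃[ z ] Above e t × Below x z × 0ℚ < z × t ^ℕ suc c < z ^ℕ ↧ₙ s
  Below-log x (mkℚ (+ suc c) d-1 _) s>0 (z , (z>0 , s , t , es , s′>0 , et , lt) , xz) =
    c , refl , t , z , et , xz , z>0 , subst (t ^ℕ suc c <_) (*-identityʳ _) lt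
  Below-log x (mkℚ (+ zero) d-1 _)   (*<* (+<+ ()))
  Below-log x (mkℚ -[1+ _ ] d-1 _)   (*<* ())

  -- As `r` and `s` are positive, so is `q`. The comparison passes through unnormalised rationals,
  -- where the product keeps its factors.
  numerators : ∀ r s q {a c} → ↥ r ≡ + suc a → ↥ s ≡ + suc c → r < q * s →
               ∃[ Q ] ↥ q ≡ + suc Q × suc a ℕ.* (↧ₙ q ℕ.* ↧ₙ s) ℕ.≤ suc Q ℕ.* suc c ℕ.* ↧ₙ r
  numerators r@(mkℚ _ b-1 _) s@(mkℚ _ d-1 _) q@(mkℚ n P-1 _) {a} {c} refl refl lt =
    by-sign n refl (ℚᵘ.<-respʳ-≃ (toℚᵘ-homo-* q s) (toℚᵘ-mono-< lt))
    where
    by-sign : ∀ m → n ≡ m → mkℚᵘ (+ suc a) b-1 ℚᵘ.< mkℚᵘ m P-1 ℚᵘ.* mkℚᵘ (+ suc c) d-1 →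
              ∃[ Q ] n ≡ + suc Q × suc a ℕ.* (suc P-1 ℕ.* suc d-1) ℕ.≤ suc Q ℕ.* suc c ℕ.* suc b-1
    by-sign (+ suc Q)  eq (*<* lt′) = Q , eq , ℕ.<⇒≤ (ℤ.drop‿+<+ lt′)
    by-sign (+ zero)   eq (*<* (+<+ ()))
    by-sign (-[1+ _ ]) eq (*<* ())

  -- Write z = (v + w) / v in lowest terms. From z = r + σ with r < 1 and σ below √2 it follows that
  -- w / v = z - 1 is at most σ.
  Below-1+√2 : ∀ z → 1ℚ < z → Below (fromℕ 1 Defs.+ √ fromℕ 2) z →
               ∃[ v-1 ] ∃[ w ] z * ι (suc v-1) ≡ ι (suc v-1 ℕ.+ w) × w ℕ.* w ℕ.≤ 2 ℕ.* (suc v-1 ℕ.* suc v-1)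
  Below-1+√2 (mkℚ -[1+ _ ] _ _) (*<* ())
  Below-1+√2 z@(mkℚ (+ u) v-1 cop) (*<* 1<z) (r , σ , r<1 , σ-below , z≡)
    with ℕ.m≤n⇒∃[o]m+o≡n (ℕ.<⇒≤ (ℤ.drop‿+<+ (subst₂ ℤ._<_ (ℤ.*-identityˡ (+ suc v-1)) (ℤ.*-identityʳ (+ u)) 1<z)))
  ... | w , refl = v-1 , w , clear-denominator u v-1 cop , w²≤ σ-below
    where
    v = suc v-1
    ιw≤σιv : ι w ≤ σ * ι v
    ιw≤σιv with ι w ≤? σ * ι v
    ... | yes le = le
    ... | no  ≰  = contradiction (begin-strict
      ι (v ℕ.+ w)          ≡⟨ clear-denominator u v-1 cop ⟨
      z * ι v              ≡⟨ cong (_* ι v) z≡ ⟩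
      (r + σ) * ι v        ≡⟨ *-distribʳ-+ (ι v) r σ ⟩
      r * ι v + σ * ι v    <⟨ +-mono-≤-< (*-monoʳ-≤-nonNeg (ι v) (<⇒≤ r<1)) (≰⇒> ≰) ⟩
      1ℚ * ι v + ι w       ≡⟨ cong (_+ ι w) (*-identityˡ (ι v)) ⟩
      ι v + ι w            ≡⟨ ι-+ v w ⟨
      ι (v ℕ.+ w)          ∎) (<-irrefl refl)
      where open ≤-Reasoning
    w²≤ : σ < 0ℚ ⊎ σ * σ < + 2 / 1 → w ℕ.* w ℕ.≤ 2 ℕ.* (v ℕ.* v)
    w²≤ (inj₁ σ<0) = contradiction (≤-<-trans (≤-trans (0≤ι w) ιw≤σιv)
      (<-≤-trans (*-monoˡ-<-pos (ι v) σ<0) (≤-reflexive (*-zeroˡ (ι v))))) (<-irrefl refl)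
    w²≤ (inj₂ σ²<2) = ι-cancel-≤ (begin
      ι (w ℕ.* w)                ≡⟨ ι-* w w ⟩
      ι w * ι w                  ≤⟨ *-mono-≤ (0≤ι w) (0≤ι w) ιw≤σιv ιw≤σιv ⟩
      σ * ι v * (σ * ι v)        ≡⟨ interchange σ (ι v) ⟩
      σ * σ * (ι v * ι v)        ≤⟨ *-monoʳ-≤-nonNeg (ι v * ι v) {{nonNegative (0≤* (0≤ι v) (0≤ι v))}} (<⇒≤ σ²<2) ⟩
      ι 2 * (ι v * ι v)          ≡⟨ cong (ι 2 *_) (ι-* v v) ⟨
      ι 2 * ι (v ℕ.* v)          ≡⟨ ι-* 2 (v ℕ.* v) ⟨
      ι (2 ℕ.* (v ℕ.* v))        ∎)
      where
      open ≤-Reasoning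
      interchange : ∀ p q → p * q * (p * q) ≡ p * p * (q * q)
      interchange p q = trans (*-assoc p q (p * q)) (trans (cong (p *_) (trans (sym (*-assoc q p q))
        (trans (cong (_* q) (*-comm q p)) (*-assoc p q q)))) (sym (*-assoc p p (q * q))))

  -- Unfolding the cuts gives r above log 2 and s > 0 below log (1 + √2) with r < ω s. The number
  -- `e` disappears because the rational below it used for `r` is less than the one above it used
  -- for `s`.
  rational-exponent : ∀ α → log (fromℕ 2) ÷ log (fromℕ 1 Defs.+ √ fromℕ 2) Defs.< α →
    ∃[ ω ] ∃[ Q ] ∃[ v-1 ] ∃[ w ] Below α ω × ↥ ω ≡ + suc Q × w ℕ.* w ℕ.≤ 2 ℕ.* (suc v-1 ℕ.* suc v-1) ×
    2 ℕ.^ ↧ₙ ω ℕ.* suc v-1 ℕ.^ suc Q ℕ.< (suc v-1 ℕ.+ w) ℕ.^ suc Q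
  rational-exponent α (ω@(mkℚ _ P _) , (r , s , log-r , log-s , s>0 , r<ωs) , αω)
    with Above-log-2 r log-r | Below-log (fromℕ 1 Defs.+ √ fromℕ 2) s s>0 log-s
  ... | a , r≡ , s′ , es , s′>0 , 2<s | c , s≡ , t , z , et , z< , z>0 , t<z
    with numerators r s ω r≡ s≡ r<ωs
  ... | Q , refl , le with compare-exponents (suc a) (↧ₙ r) c (↧ₙ s) P (suc Q) (<⇒≤ s′>0)
                             (<⇒≤ (Below-e<Above-e es et)) (<⇒≤ (Above-e⇒1< et)) (<⇒≤ z>0) 2<s t<z le
  ... | 2<z with Below-1+√2 z 1<z z<
    where
    1<z : 1ℚ < z
    1<z with 1ℚ <? z
    ... | yes 1<z = 1<z
    ... | no  1≮z = contradiction (<-≤-trans 2<z (^≤1 (suc Q) (<⇒≤ z>0) (≮⇒≥ 1≮z)))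
                      λ lt → <-irrefl refl (<-≤-trans lt (1≤^ (suc P) 1≤2))
  ... | v-1 , w , zv≡ , w²≤ = ω , Q , v-1 , w , αω , refl , w²≤ , ι-cancel-< (begin-strict
    ι (2 ℕ.^ suc P ℕ.* v ℕ.^ suc Q)       ≡⟨ ι-* (2 ℕ.^ suc P) (v ℕ.^ suc Q) ⟩
    ι (2 ℕ.^ suc P) * ι (v ℕ.^ suc Q)     ≡⟨ cong₂ _*_ (ι-^ 2 (suc P)) (ι-^ v (suc Q)) ⟩
    ι 2 ^ℕ suc P * ι v ^ℕ suc Q           <⟨ *-monoˡ-<-pos (ι v ^ℕ suc Q) {{positive (0<^ (suc Q) (ι-mono-< (s≤s z≤n)))}} 2<z ⟩
    z ^ℕ suc Q * ι v ^ℕ suc Q             ≡⟨ ^-distrib-* z (ι v) (suc Q) ⟨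
    (z * ι v) ^ℕ suc Q                    ≡⟨ cong (_^ℕ suc Q) zv≡ ⟩
    ι (v ℕ.+ w) ^ℕ suc Q                  ≡⟨ ι-^ (v ℕ.+ w) (suc Q) ⟨
    ι ((v ℕ.+ w) ℕ.^ suc Q)               ∎)
    where
    open ≤-Reasoning
    v = suc v-1

  -- A lower witness for a power needs a positive rational strictly below the base; this is `ι k`,
  -- which explains why the premise is about `k` and the conclusion about `suc k`.
  fromℕ-≤-^ : ∀ α ω Q m k → Below α ω → ↥ ω ≡ + suc Q → 1 ℕ.≤ k → m ℕ.^ ↧ₙ ω ℕ.≤ k ℕ.^ suc Q →
              fromℕ m Defs.≤ fromℕ (suc k) Defs.^ α
  fromℕ-≤-^ α ω@(mkℚ _ P _) Q m k αω refl 1≤k le q q<m = ω , αω , below (q ≤? 0ℚ)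
    where
    open ≤-Reasoning
    below : _ → Below (fromℕ (suc k) ^ℚ ω) q
    below (yes q≤0) = inj₁ q≤0
    below (no  q≰0) = inj₂ (ι k , ι (2 ℕ.+ k) ,
      subst (ι k <_) (ι≡/1 (suc k)) (ι-mono-< ℕ.≤-refl) , ι-mono-< 1≤k ,
      subst (_< ι (2 ℕ.+ k)) (ι≡/1 (suc k)) (ι-mono-< ℕ.≤-refl) , (begin-strict
        q ^ℕ suc P * 1ℚ     ≡⟨ *-identityʳ (q ^ℕ suc P) ⟩
        q ^ℕ suc P          <⟨ ^-mono-< P (<⇒≤ (≰⇒> q≰0)) (subst (q <_) (sym (ι≡/1 m)) q<m) ⟩
        ι m ^ℕ suc P        ≡⟨ ι-^ m (suc P) ⟨
        ι (m ℕ.^ suc P)     ≤⟨ ι-mono-≤ le ⟩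
        ι (k ℕ.^ suc Q)     ≡⟨ ι-^ k (suc Q) ⟩
        ι k ^ℕ suc Q        ∎))

-- Cycle spectra of the constructed ladders, and the conclusion.

module Spectra where
  open import Defs using (Graph; Subdivision; ladder; HasCycle; HasCardinality; Λ; ℝ; cut; Below; fromℕ)
  import Defs
  open CyclicSequences
  open LadderCycles
  open Orbits
  open SubdividedLadders
  open SimplexSums
  open CountingDifferences
  open Exponents
  open RealExponents using (rational-exponent; fromℕ-≤-^)
  open import Data.Integer.Base using (+_)
  open import Data.Nat.Base
  open import Data.Nat.Properties
  open import Data.Nat.Tactic.RingSolver using (solve-∀)
  open import Data.Rational.Base using (↥_; ↧ₙ_; mkℚ)

  open Counting using (#differences)

  module FiniteGraph (G : Graph) (_≟ᵛ_ : DecidableEquality (Graph.Vertex G)) (_~?_ : Decidable (Graph._~_ G))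
                     (vertices : List (Graph.Vertex G)) (complete : ∀ x → x ∈ vertices) where
    open Graph G

    lists : ℕ → List (List Vertex)
    lists zero    = [] ∷ []
    lists (suc n) = cartesianProductWith _∷_ vertices (lists n)

    ∈-lists : ∀ xs → xs ∈ lists (length xs)
    ∈-lists []       = here refl
    ∈-lists (x ∷ xs) = ∈-cartesianProductWith⁺ _∷_ (complete x) (∈-lists xs)

    IsCycle : ℕ → List Vertex → Set
    IsCycle ℓ []       = ⊥
    IsCycle ℓ (x ∷ xs) = length (x ∷ xs) ≡ ℓ × 3 ≤ ℓ × Unique (x ∷ xs) × Linked _~_ (x ∷ xs ∷ʳ x)

    isCycle? : ∀ ℓ xs → Dec (IsCycle ℓ xs)
    isCycle? ℓ []       = no id
    isCycle? ℓ (x ∷ xs) = (length (x ∷ xs) ≟ ℓ) ×-dec (3 ≤? ℓ) ×-dec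
                          allPairs? (λ x y → ¬? (x ≟ᵛ y)) (x ∷ xs) ×-dec linked? _~?_ (x ∷ xs ∷ʳ x)

    hasCycle? : ∀ ℓ → Dec (HasCycle G ℓ)
    hasCycle? ℓ = map′ from to (any? (isCycle? ℓ) (lists ℓ))
      where
      from : Any.Any (IsCycle ℓ) (lists ℓ) → HasCycle G ℓ
      from cycles with find cycles
      ... | x ∷ xs , _ , cycle = x , xs , cycle
      to : HasCycle G ℓ → Any.Any (IsCycle ℓ) (lists ℓ)
      to (x , xs , refl , cycle) = lose (∈-lists (x ∷ xs)) (refl , cycle)

  -- A cardinality is an exact enumeration, so containment in `ns` has to be combined with a
  -- decision procedure. For spectra this is an exhaustive search over vertex lists.
  cardinality-≤ : ∀ {A : Pred ℕ _} → Unary.Decidable A → ∀ ns → (∀ {ℓ} → A ℓ → ℓ ∈ ns) →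
                  ∃[ m ] HasCardinality A m × m ≤ length ns
  cardinality-≤ {A} A? ns A⊆ns = length xs , (xs , unique , (λ ℓ → mk⇔ to from) , refl) , bound
    where
    xs = filter A? (deduplicate _≟_ ns)
    unique : Unique xs
    unique = AllPairs.filter⁺ A? (deduplicate-! _≟_ ns)
    to : ∀ {ℓ} → A ℓ → ℓ ∈ xs
    to a = ∈-filter⁺ A? (∈-deduplicate⁺ _≟_ (A⊆ns a)) a
    from : ∀ {ℓ} → ℓ ∈ xs → A ℓ
    from ℓ∈ = proj₂ (∈-filter⁻ A? {xs = deduplicate _≟_ ns} ℓ∈)
    bound : length xs ≤ length ns
    bound = ≤-trans (length-filter A? (deduplicate _≟_ ns)) (length-deduplicate _≟_ ns)

  module Spectrum (h ρ : ℕ → ℕ) (h0≡0 : h 0 ≡ 0) (k : ℕ) where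
    open LadderWalk h ρ
    open SubdividedLadder h ρ h0≡0 k
    open Vertex

    _⟶?_ : Decidable _⟶_
    (i , m) ⟶? (i′ , m′) = map′ from to
      ((i ≟ i′ ×-dec m′ ≟ suc m) ⊎-dec (suc i ≟ i′ ×-dec m ≟ h i ×-dec m′ ≟ 0) ⊎-dec
       (suc i ≟ i′ ×-dec m ≟ e i ×-dec m′ ≟ e (suc i)))
      where
      from : i ≡ i′ × m′ ≡ suc m ⊎ suc i ≡ i′ × m ≡ h i × m′ ≡ 0 ⊎ suc i ≡ i′ × m ≡ e i × m′ ≡ e (suc i) → (i , m) ⟶ (i′ , m′)
      from (inj₁ (refl , eq))              = vertical eq
      from (inj₂ (inj₁ (refl , eq , refl))) = along-top eq
      from (inj₂ (inj₂ (refl , eq , eq′)))  = along-bottom eq eq′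
      to : (i , m) ⟶ (i′ , m′) → i ≡ i′ × m′ ≡ suc m ⊎ suc i ≡ i′ × m ≡ h i × m′ ≡ 0 ⊎ suc i ≡ i′ × m ≡ e i × m′ ≡ e (suc i)
      to (vertical eq)         = inj₁ (refl , eq)
      to (along-top eq)        = inj₂ (inj₁ (refl , eq , refl))
      to (along-bottom eq eq′) = inj₂ (inj₂ (refl , eq , eq′))

    vertices : List Vertex
    vertices = concatMap (λ j → strip (toℕ j) 0 (suc (e (toℕ j))) (toℕ<n j) ≤-refl) (allFin k)

    ∈-vertices : ∀ x → x ∈ vertices
    ∈-vertices x with column-index x
    ... | j , j≡ = ∈-concatMap⁺ (λ j → strip (toℕ j) 0 (suc (e (toℕ j))) (toℕ<n j) ≤-refl) (lose (∈-allFin j)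
      (∈-strip (toℕ j) 0 (suc (e (toℕ j))) (toℕ<n j) ≤-refl x (sym j≡ , z≤n , s≤s (subst (λ c → row x ≤ e c) (sym j≡) (row-bound x)))))

    _≟ᵛ_ : DecidableEquality Vertex
    x ≟ᵛ y = map′ site-injective (cong site) (≡-dec _≟_ _≟_ (site x) (site y))

    _~?_ : Decidable (Graph._~_ graph)
    x ~? y = (site x ⟶? site y) ⊎-dec (site y ⟶? site x)

    open FiniteGraph graph _≟ᵛ_ _~?_ vertices ∈-vertices public using (hasCycle?)

    column-bound : ∀ x → column x < k
    column-bound x with column-index x
    ... | j , j≡ = subst (_< k) j≡ (toℕ<n j)

    -- The cycle is read from a vertex in its rightmost column, found as an argmax over the vertex
    -- list.
    hasCycle-length : ∀ {ℓ} → HasCycle graph ℓ →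
                      ∃[ a ] ∃[ n ] suc n + a < k × ℓ ≡ rung a + rung (suc n + a) + span a (suc n)
    hasCycle-length (x , xs , refl , 3≤ℓ , unique , linked)
      with ∈-orbit ([ here , there ]′ (argmax-sel column x xs))
    ... | s , last with cycle-length (orbit-cyclic site site-injective id unique linked) 3≤ℓ s
                          (λ t → subst (column (orbit x xs t) ≤_) (cong column (sym last))
                                   (All.lookup (f[⊥]≤f[argmax] {f = column} x xs ∷ f[xs]≤f[argmax] {f = column} x xs) (orbit-∈ x xs t)))
                          (λ t → row-bound (orbit x xs t))
    ...   | a , n , eq , ℓ≡ = a , n , subst (_< k) (sym eq) (column-bound (orbit x xs s)) ,
      subst (λ j → suc (length xs) ≡ rung a + rung j + span a (suc n)) (sym eq) ℓ≡

  module _ {A : Set} where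

    nth : A → List A → ℕ → A
    nth d []       _       = d
    nth d (x ∷ xs) zero    = x
    nth d (x ∷ xs) (suc i) = nth d xs i

    nth-all : ∀ {P : A → Set} {d xs} → All P xs → ∀ {i} → i < length xs → P (nth d xs i)
    nth-all (p ∷ ps) {zero}  _  = p
    nth-all (p ∷ ps) {suc i} lt = nth-all ps (s≤s⁻¹ lt)

    nth-consecutive : ∀ {R : A → A → Set} {d xs} → AllPairs R xs → ∀ {i} → suc i < length xs →
                      R (nth d xs i) (nth d xs (suc i))
    nth-consecutive ((r ∷ _) ∷ _) {zero}  _  = r
    nth-consecutive ([] ∷ _)      {zero}  (s≤s ())
    nth-consecutive (_ ∷ rs)      {suc i} lt = nth-consecutive rs (s≤s⁻¹ lt)

  -- Rung i has length 2 (x i + y i) + 1 and position 2 (x i − y i), where distances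
  -- count the top and the bottom path together; the factor 2 makes room for both.
  module Telescope (x y : ℕ → ℕ) (k : ℕ) (increasing : ∀ {i} → suc i < k → x i + y (suc i) < x (suc i) + y i) where

    ρ h : ℕ → ℕ
    ρ i       = 2 * (x i + y i)
    h zero    = 0
    -- The `suc` removes the two edges by which `span` exceeds `h` per column; `increasing` makes
    -- the truncated subtraction exact for neighbouring rungs.
    h (suc i) = 2 * ((x (suc i) + y i) ∸ suc (x i + y (suc i)))

    open LadderWalk h ρ using (span; rung)

    gap : ∀ {i} → suc i < k → 2 + h (suc i) + 2 * (x i + y (suc i)) ≡ 2 * (x (suc i) + y i)
    gap {i} lt = trans (solve ((x (suc i) + y i) ∸ suc (x i + y (suc i))) (x i + y (suc i)))
      (cong (2 *_) (m∸n+n≡m (increasing lt)))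
      where
      solve : ∀ d s → 2 + 2 * d + 2 * s ≡ 2 * (d + suc s)
      solve = solve-∀

    span-telescopes : ∀ a n → n + a < k → span a n + 2 * (x a + y (n + a)) ≡ 2 * (x (n + a) + y a)
    span-telescopes a zero    lt = refl
    span-telescopes a (suc n) lt = +-cancelʳ-≡ (2 * (x b + y b)) _ _ (begin
      2 + h (suc b) + span a n + 2 * (x a + y (suc b)) + 2 * (x b + y b)
        ≡⟨ solve₁ (h (suc b)) (span a n) (x a) (y (suc b)) (x b) (y b) ⟩
      (2 + h (suc b) + 2 * (x b + y (suc b))) + (span a n + 2 * (x a + y b))
        ≡⟨ cong₂ _+_ (gap lt) (span-telescopes a n (<-trans (n<1+n b) lt)) ⟩
      2 * (x (suc b) + y b) + 2 * (x b + y a)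
        ≡⟨ solve₂ (x (suc b)) (y b) (x b) (y a) ⟩
      2 * (x (suc b) + y a) + 2 * (x b + y b) ∎)
      where
      open ≡-Reasoning
      b = n + a
      solve₁ : ∀ h s xa y′ x y → 2 + h + s + 2 * (xa + y′) + 2 * (x + y) ≡ (2 + h + 2 * (x + y′)) + (s + 2 * (xa + y))
      solve₁ = solve-∀
      solve₂ : ∀ x′ y x ya → 2 * (x′ + y) + 2 * (x + ya) ≡ 2 * (x′ + ya) + 2 * (x + y)
      solve₂ = solve-∀

    -- Between the positions 2 (x - y) and the rung lengths 2 (x + y) + 1, the `y` of the right rung
    -- and the `x` of the left rung cancel, while the other two terms double.
    length-telescopes : ∀ a n → n + a < k → rung a + rung (n + a) + span a n ≡ 2 + 4 * (x (n + a) + y a)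
    length-telescopes a n lt = trans (solve₁ (x a) (y a) (x b) (y b) (span a n))
      (trans (cong (λ s → 2 * (x b + y a) + 2 + s) (span-telescopes a n lt)) (solve₂ (x b + y a)))
      where
      b = n + a
      solve₁ : ∀ xa ya x y s → suc (2 * (xa + ya)) + suc (2 * (x + y)) + s ≡ 2 * (x + ya) + 2 + (s + 2 * (xa + y))
      solve₁ = solve-∀
      solve₂ : ∀ s → 2 * s + 2 + 2 * s ≡ 2 + 4 * s
      solve₂ = solve-∀

  small-spectrum : ∀ N d p q → p + q ≤ N →
                   let k = #differences N d p q in
                   Σ[ G ∈ Graph ] Subdivision (ladder k) G × (∃[ m ] HasCardinality (Λ G) m × m ≤ 2 ^ (d + (p + q)))
  small-spectrum N d p q p+q≤N =
    graph , subdivision , conclude (cardinality-≤ hasCycle? lengths lengths-complete)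
    where
    open Sumset N
    k : ℕ
    k = length (differences d p q)
    xy : ℕ → ℕ × ℕ
    xy = nth (0 , 0) (differences d p q)
    open Telescope (proj₁ ∘ xy) (proj₂ ∘ xy) k (nth-consecutive (differences-increasing d p q p+q≤N))
    open SubdividedLadder h ρ refl k using (graph; subdivision)
    open Spectrum h ρ refl k using (hasCycle?; hasCycle-length)
    lengths : List ℕ
    lengths = map (λ s → 2 + 4 * s) (sums d (p + q))
    lengths-complete : ∀ {ℓ} → HasCycle graph ℓ → ℓ ∈ lengths
    lengths-complete cycle with hasCycle-length cycle
    ... | a , n , j<k , refl = subst (_∈ lengths) (sym (length-telescopes a (suc n) j<k))
      (∈-map⁺ (λ s → 2 + 4 * s) (sums-complete (simplex-+ (proj₁ (in-simplex j<k)) (proj₂ (in-simplex (≤-<-trans (m≤n+m a (suc n)) j<k))))))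
      where
      in-simplex : ∀ {i} → i < k → InDifferences d p q (xy i)
      in-simplex = nth-all (in-differences d p q)
    conclude : (∃[ m ] HasCardinality (Λ graph) m × m ≤ length lengths) →
               ∃[ m ] HasCardinality (Λ graph) m × m ≤ 2 ^ (d + (p + q))
    conclude (m , card , le) = m , card ,
      ≤-trans le (≤-trans (≤-reflexive (length-map (λ s → 2 + 4 * s) (sums d (p + q)))) (length-sums d (p + q)))

  -- Since 1 ≤ k gives suc k ≤ 2 k, the spare factor `2 ^ Q` allows the step from `suc k` down to
  -- `k`.
  halve : ∀ {m} P Q k → 1 ≤ k → m ≤ 2 ^ P → ∀ R → (2 ^ P) ^ R * 2 ^ Q ≤ suc k ^ Q → m ^ R ≤ k ^ Q
  halve {m} P Q k 1≤k m≤ R le = ≤-trans (^-monoˡ-≤ R m≤) (*-cancelʳ-≤ ((2 ^ P) ^ R) (k ^ Q) (2 ^ Q) {{m^n≢0 2 Q}} (begin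
    (2 ^ P) ^ R * 2 ^ Q  ≤⟨ le ⟩
    suc k ^ Q            ≤⟨ ^-monoˡ-≤ Q (≤-trans (+-monoˡ-≤ k 1≤k) (≤-reflexive (solve k))) ⟩
    (k * 2) ^ Q          ≡⟨ ^-distribʳ-* Q k 2 ⟩
    k ^ Q * 2 ^ Q        ∎))
    where
    open ≤-Reasoning
    solve : ∀ k → k + k ≡ k * 2
    solve = solve-∀

  FewCycleLengths : ℕ → ℝ → Set₁
  FewCycleLengths n α = ∃[ k ] Σ[ G ∈ Graph ] (n ≤ k × 1 ≤ k × Subdivision (ladder k) G ×
    (∃[ m ] HasCardinality (Λ G) m × fromℕ m Defs.≤ fromℕ k Defs.^ cut α))

  few-cycle-lengths : ∀ n α ω Q v-1 w → Below (cut α) ω → ↥ ω ≡ + suc Q → w * w ≤ 2 * (suc v-1 * suc v-1) →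
                      2 ^ ↧ₙ ω * suc v-1 ^ suc Q < (suc v-1 + w) ^ suc Q → FewCycleLengths n α
  few-cycle-lengths n α ω@(mkℚ _ P _) Q v-1 w αω ω≡ w²≤2v² lt =
    -- The threshold 2 + n keeps the predecessor of the number of rungs at least 1, even for n = 0.
    construct (sparse (suc P) (suc Q) (suc v-1) w w²≤2v² lt (2 + n))
    where
    conclude : ∀ N k → 2 + n ≤ k → (2 ^ N) ^ suc P * 2 ^ suc Q ≤ k ^ suc Q →
               (Σ[ G ∈ Graph ] Subdivision (ladder k) G × (∃[ m ] HasCardinality (Λ G) m × m ≤ 2 ^ N)) → FewCycleLengths n α
    conclude N (suc k) (s≤s n<k) large (G , sub , m , card , m≤) =
      suc k , G , ≤-trans (n≤1+n n) (m≤n⇒m≤1+n n<k) , s≤s z≤n , sub , m , card ,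
      fromℕ-≤-^ (cut α) ω Q m k αω ω≡ 1≤k (halve N (suc Q) k 1≤k m≤ (suc P) large)
      where
      1≤k : 1 ≤ k
      1≤k = ≤-trans (s≤s z≤n) n<k

    construct : (∃[ N ] ∃[ d ] ∃[ p ] ∃[ q ] d + (p + q) ≡ N ×
                 2 + n ≤ #differences N d p q × (2 ^ N) ^ suc P * 2 ^ suc Q ≤ #differences N d p q ^ suc Q) → FewCycleLengths n α
    construct (N , d , p , q , eq , n<k , large) = conclude N (#differences N d p q) n<k large
      (subst (λ M → Σ[ G ∈ Graph ] Subdivision (ladder (#differences N d p q)) G × (∃[ m ] HasCardinality (Λ G) m × m ≤ 2 ^ M))
        eq (small-spectrum N d p q (≤-trans (m≤n+m (p + q) d) (≤-reflexive eq))))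

open RealExponents using (rational-exponent)
open Spectra using (few-cycle-lengths)

open import Defs
open import Data.Nat.Base as ℕ using (ℕ)

theorem1p5 : (n : ℕ) (α : ℝ) →
    log (fromℕ 2) ÷ log (fromℕ 1 + √ fromℕ 2) < cut α →
    ∃[ k ] Σ[ G ∈ Graph ] (n ℕ.≤ k × 1 ℕ.≤ k × Subdivision (ladder k) G ×
    (∃[ m ] HasCardinality (Λ G) m × fromℕ m ≤ fromℕ k ^ cut α))
theorem1p5 n α α-large =
  let ω , Q , v-1 , w , αω , ω≡ , w²≤2v² , lt = rational-exponent (cut α) α-large
  in few-cycle-lengths n α ω Q v-1 w αω ω≡ w²≤2v² lt
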